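{- Let $n$ be a positive integer and let $\Gamma$ be an Abelian group of order $n^2>1$. There exists a (non-trivial) zero-sum $\Gamma$-magic square of side $n$ if and only if $n>2$ and $\Gamma\in\mathcal{G}$, where $\mathcal{G}$ is the set of all finite Abelian groups that have odd order or contain more than one involution.
   Context: An Abelian group $(\Gamma,+)$ has identity $0$. An involution of $\Gamma$ is an element $\iota\neq 0$ with $2\iota=0$. The set $\mathcal{G}$ consists of all finite Abelian groups that are of odd order (hence have no involution) or contain more than one involution. For an Abelian group $\Gamma$ of order $n^2$, a $\Gamma$-magic square of side $n$ is an $n\times n$ array whose entries are the elements of $\Gamma$, each appearing exactly once, such that all row sums, all column sums, the main diagonal sum and the main antidiagonal sum are equal to the same element $\mu\in\Gamma$, called the magic constant. A zero-sum $\Gamma$-magic square is a $\Gamma$-magic square with magic constant $\mu=0$. The square is trivial if $n=1$ and non-trivial otherwise. -}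

module Defs where

open import Level using (Level; _⊔_)
open import Algebra.Bundles using (AbelianGroup)
open import Data.Nat.Base using (ℕ)
open import Data.Nat.Divisibility using (_∣_)
open import Data.Fin.Base using (Fin; opposite)
open import Data.Product using (_×_; _,_; ∃; ∃-syntax; ∃!)
open import Data.Sum.Base using (_⊎_)
open import Function.Bundles using (Inverse)
open import Relation.Nullary using (¬_)
open import Relation.Binary.PropositionalEquality using (_≡_; _≢_; setoid)
import Algebra.Properties.CommutativeMonoid.Sum as Sum

private
  variable
    c ℓ : Level

-- Elements are counted up to the group's own equality _≈_.
HasOrder : AbelianGroup c ℓ → ℕ → Set (c ⊔ ℓ)
HasOrder Γ m = Inverse (setoid (Fin m)) (AbelianGroup.setoid Γ)

module _ (Γ : AbelianGroup c ℓ) where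
  open AbelianGroup Γ using (Carrier; _≈_; _∙_; ε)

  IsInvolution : Carrier → Set ℓ
  IsInvolution ι = ¬ (ι ≈ ε) × (ι ∙ ι ≈ ε)

  MoreThanOneInvolution : Set (c ⊔ ℓ)
  MoreThanOneInvolution =
    ∃[ ι ] ∃[ κ ] (IsInvolution ι × IsInvolution κ × ¬ (ι ≈ κ))

-- Γ ∈𝒢 asserts in particular that Γ is finite, of some order m.
_∈𝒢 : AbelianGroup c ℓ → Set (c ⊔ ℓ)
Γ ∈𝒢 = ∃[ m ] (HasOrder Γ m × (¬ (2 ∣ m) ⊎ MoreThanOneInvolution Γ))

record MagicSquare (Γ : AbelianGroup c ℓ) (n : ℕ) : Set (c ⊔ ℓ) where
  open AbelianGroup Γ using (Carrier; _≈_; commutativeMonoid)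
  open Sum commutativeMonoid using (sum)
  field
    entry        : Fin n → Fin n → Carrier
    each-once    : ∀ g → ∃! _≡_ λ ((i , j) : Fin n × Fin n) → entry i j ≈ g
    μ            : Carrier
    row-sum      : ∀ i → sum (λ j → entry i j) ≈ μ
    column-sum   : ∀ j → sum (λ i → entry i j) ≈ μ
    diagonal     : sum (λ i → entry i i) ≈ μ
    antidiagonal : sum (λ i → entry i (opposite i)) ≈ μ

module _ {Γ : AbelianGroup c ℓ} {n : ℕ} where
  open AbelianGroup Γ using (_≈_; ε)

  ZeroSum : MagicSquare Γ n → Set ℓ
  ZeroSum S = MagicSquare.μ S ≈ ε

  NonTrivial : MagicSquare Γ n → Set
  NonTrivial _ = n ≢ 1

{-# OPTIONS --safe #-}
module Submission where

-- Necessity. A 2 × 2 square with zero line sums repeats an entry. The rows of a zero-sum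
-- square show that the elements of Γ add up to 0; pairing x with -x, this sum is also
-- the sum of the involutions. So there is not exactly one of them, while an even order
-- forces at least one.
--
-- Sufficiency. Adjoining elements of prime order one by one splits any finite abelian
-- group of order ab as T + H with |T| = a, |H| = b and T, H each invariant under some
-- reflection x ↦ s - x. For odd n, translate T and H of size n to be symmetric about 0
-- and superpose them along the orthogonal Latin squares i + j and i - j.
--
-- For n = 2m choose a Klein four-group V = {0, a, b, a + b} in Γ. Replacing each entry
-- of a zero-sum square of Γ/V of side m by a 2 × 2 block filled with its coset gives
-- equal row sums, and equal column sums, within each block; all line sums are twice an
-- element of V plus a sum of involutions, which the choice of the blocks makes zero.
-- This settles odd m. For even m it reduces side n to side m when every involution is
-- a double, as halves of a and b then give two involutions in Γ/V; here n = 4 is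
-- treated directly. If some involution σ is not a double, then Γ = K ⊕ ⟨σ⟩, and the
-- classical complementary-pairs construction of doubly even squares applies.

open import Defs
open import Level using (Level; _⊔_) renaming (suc to lsuc)
open import Algebra.Bundles using (AbelianGroup; CommutativeMonoid; CommutativeRing)
import Algebra.Properties.AbelianGroup as AbelianGroupProperties
import Algebra.Properties.CommutativeMonoid.Mult as Mult
import Algebra.Properties.CommutativeMonoid.Sum as Sum
import Algebra.Properties.CommutativeSemigroup as CommutativeSemigroupProperties
import Algebra.Properties.Group as GroupProperties
import Algebra.Solver.CommutativeMonoid as CommutativeMonoidSolver
open import Data.Bool.Base using (Bool; true; false; not; _xor_)
open import Data.Bool.Properties using (not-involutive; xor-comm; xor-∧-commutativeRing)
open import Data.Empty using (⊥-elim)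
import Data.Fin.Base as Fin
open import Data.Fin.Base using (Fin; zero; suc; opposite; punchIn; punchOut; fromℕ; inject₁; combine;
  remQuot; toℕ; _↑ˡ_; _↑ʳ_)
open import Data.Fin.Patterns using (0F; 1F; 2F; 3F)
open import Data.Fin.Permutation using (permutation)
open import Data.Fin.Properties using (_≟_; any?; all?; <-cmp; punchInᵢ≢i; punchOut-injective; injective⇒≤;
  opposite-prop; opposite-involutive; toℕ-inject₁; toℕ-injective; toℕ<n; toℕ-fromℕ<; toℕ-combine;
  remQuot-combine; combine-remQuot)
open import Data.Nat.Base using (ℕ; zero; suc; _^_; _+_; _*_; _∸_; _<_; z≤n; s≤s; NonZero;
  nonTrivial⇒nonZero; nonTrivial⇒n>1; pred; ≢-nonZero; ≢-nonZero⁻¹; >-nonZero)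
open import Data.Nat.Coprimality using (coprime-Bézout; prime⇒coprime)
open import Data.Nat.Divisibility using (_∣?_; divides; quotient-<; quotient≢0)
open import Data.Nat.DivMod using (_%_; _/_; _mod_; m≡m%n+[m/n]*n; m%n<n; %-distribˡ-+; [m+kn]%n≡m%n;
  [m+n]%n≡m%n; m<n⇒m%n≡m)
open import Data.Nat.GCD using (module Bézout)
open import Data.Nat.Induction using (<-wellFounded)
open import Data.Nat.Primality using (Prime; prime[2]; prime?; ¬prime⇒composite; composite; prime⇒nonZero;
  prime⇒nonTrivial; euclidsLemma)
import Data.Nat.Properties as ℕ
open import Data.Nat.Solver using (module +-*-Solver)
open import Data.Product using (_×_; _,_; proj₁; proj₂; ∃; ∃-syntax; Σ-syntax; map; swap; uncurry)
open import Data.Product.Properties using (,-injective)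
import Data.Sum.Base as ⊎
open import Data.Sum.Base using (_⊎_; inj₁; inj₂; [_,_]′)
import Data.Vec.Base as Vec
open import Data.Vec.Base using (Vec; []; _∷_; lookup; allFin)
open import Data.Vec.N-ary using (N-ary; curryⁿ; _$ⁿ_; Eq; curryⁿ-cong)
open import Function.Base using (_∘_; id; case_of_)
open import Function.Bundles using (Inverse; _⇔_; mk⇔)
open import Function.Definitions using (Injective)
open import Induction.WellFounded using (Acc; acc)
open import Relation.Binary using (Rel; Setoid; IsEquivalence; Decidable; Tri; tri<; tri≈; tri>)
open import Relation.Binary.PropositionalEquality as ≡ using (_≡_; _≢_)
import Relation.Binary.Reasoning.Setoid as SetoidReasoning
open import Relation.Nullary using (¬_; Dec; yes; no; contradiction)
open import Relation.Nullary.Decidable using (map′; True; toWitness; ¬?; _→-dec_; _×-dec_)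
open import Relation.Unary using (Pred) renaming (Decidable to Decidable₁)

-- The obstacle for even n is that descent to Γ/V may fail: V can be the only Klein four-group while
-- Γ/V has a single involution, as for Z/2 + Z/32, where Γ/V is cyclic of order 16. Halves g, h of
-- a, b exclude this, because doubling kills V and so separates the cosets of 0, g and h. An
-- involution σ without a half is nonzero in Γ/2Γ; this is an elementary abelian 2-group, so some
-- hyperplane avoids σ, and its preimage in Γ is the complement K. For odd m no such distinction is
-- needed: Γ/V has odd order. In the odd construction the translation is possible because reversal
-- of an odd number of indices has a fixed point, whose tile element is an exact half of s.

private
  variable
    c ℓ : Level

-- Finite setoids: enumerations, cardinality, classes of a coarser relation.

injective⇒surjective : ∀ {n} {f : Fin n → Fin n} → Injective _≡_ _≡_ f →
                       ∀ y → ∃[ x ] f x ≡ y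
injective⇒surjective {suc n} {f} inj y with any? (λ x → f x ≟ y)
... | yes found = found
... | no missed = contradiction (injective⇒≤ missing-inj) ℕ.1+n≰n
  where
  f≢y : ∀ x → y ≢ f x
  f≢y x y≡fx = missed (x , ≡.sym y≡fx)
  missing-inj : Injective _≡_ _≡_ (λ x → punchOut (f≢y x))
  missing-inj {i} {j} eq = inj (punchOut-injective (f≢y i) (f≢y j) eq)

Finite : Setoid c ℓ → ℕ → Set (c ⊔ ℓ)
Finite S N = Inverse (≡.setoid (Fin N)) S

module _ (S : Setoid c ℓ) where
  open Setoid S using (Carrier; _≈_) renaming (refl to ≈-refl; sym to ≈-sym; trans to ≈-trans;
    reflexive to ≈-reflexive)

  mkFinite : ∀ {N} (f : Fin N → Carrier) → Injective _≡_ _≈_ f →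
             (∀ x → ∃[ i ] f i ≈ x) → Finite S N
  mkFinite f inj surj = record
    { to = f
    ; from = λ x → proj₁ (surj x)
    ; to-cong = ≈-reflexive ∘ ≡.cong f
    ; from-cong = λ {x} {y} x≈y →
        inj (≈-trans (proj₂ (surj x)) (≈-trans x≈y (≈-sym (proj₂ (surj y)))))
    ; inverse = (λ { {x} ≡.refl → proj₂ (surj x) })
              , λ {i} {x} x≈fi → inj (≈-trans (proj₂ (surj x)) x≈fi)
    }

  mkFinite-× : ∀ {m n} (f : Fin m → Fin n → Carrier) →
               (∀ {i i′ j j′} → f i j ≈ f i′ j′ → i ≡ i′ × j ≡ j′) →
               (∀ x → ∃[ i ] ∃[ j ] f i j ≈ x) → Finite S (m * n)
  mkFinite-× {m} {n} f inj onto = mkFinite (uncurry f ∘ remQuot {m} n)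
    (λ {k} {l} eq → let (i≡i′ , j≡j′) = inj eq in begin
      k                                  ≡⟨ combine-remQuot {m} n k ⟨
      uncurry combine (remQuot {m} n k)  ≡⟨ ≡.cong₂ combine i≡i′ j≡j′ ⟩
      uncurry combine (remQuot {m} n l)  ≡⟨ combine-remQuot {m} n l ⟩
      l                                  ∎)
    (λ x → let (i , j , eq) = onto x in
      combine i j , ≈-trans (≈-reflexive (≡.cong (uncurry f) (remQuot-combine i j))) eq)
    where open ≡.≡-Reasoning

  module FiniteProperties {N} (I : Finite S N) where
    open Inverse I public

    to-injective : Injective _≡_ _≈_ to
    to-injective eq = ≡.trans (≡.sym (strictlyInverseʳ _)) (≡.trans (from-cong eq) (strictlyInverseʳ _))

    from-injective : Injective _≈_ _≡_ from
    from-injective eq =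
      ≈-trans (≈-sym (strictlyInverseˡ _)) (≈-trans (to-cong eq) (strictlyInverseˡ _))

    _≈?_ : Decidable _≈_
    x ≈? y = map′ from-injective from-cong (from x ≟ from y)

    search : ∀ {p} {P : Pred Carrier p} → (∀ {x y} → x ≈ y → P x → P y) → Decidable₁ P → Dec (∃ P)
    search resp P? =
      map′ (λ (i , Pi) → to i , Pi)
           (λ (x , Px) → from x , resp (≈-sym (strictlyInverseˡ x)) Px)
           (any? (P? ∘ to))

    injective⇒onto : {f : Fin N → Carrier} → Injective _≡_ _≈_ f → ∀ x → ∃[ i ] f i ≈ x
    injective⇒onto {f} inj x with i , eq ← injective⇒surjective {f = from ∘ f} (inj ∘ from-injective)
      (from x)
      = i , from-injective eq

  Finite-unique : ∀ {M N} → Finite S M → Finite S N → M ≡ N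
  Finite-unique I J = ℕ.≤-antisym (injective⇒≤ (I.to-injective ∘ J.from-injective))
                                  (injective⇒≤ (J.to-injective ∘ I.from-injective))
    where
    module I = FiniteProperties I
    module J = FiniteProperties J

module _ {A : Set c} {_~_ : Rel A ℓ} (equiv : IsEquivalence _~_) (_~?_ : Decidable _~_) where
  open IsEquivalence equiv using () renaming (refl to ~-refl; sym to ~-sym)

  -- The head of the enumeration is kept exactly when no representative chosen from the tail is
  -- equivalent to it, so decidability of `_~_` is enough to choose.
  representatives : ∀ {N} (e : Fin N → A) →
    ∃[ q ] ∃[ r ] (Injective (_≡_ {A = Fin q}) _~_ r × (∀ i → ∃[ j ] r j ~ e i))
  representatives {zero}  e = 0 , (λ ()) , (λ { {()} }) , λ ()
  representatives {suc N} e with representatives (e ∘ suc)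
  ... | q , r , r-inj , covers with any? (λ j → r j ~? e zero)
  ... | yes old = q , r , r-inj , λ { zero → old ; (suc i) → covers i }
  ... | no  new = suc q , r⁺ , r⁺-inj , λ { zero → zero , ~-refl ; (suc i) → map suc id (covers i) }
    where
    r⁺ : Fin (suc q) → A
    r⁺ zero    = e zero
    r⁺ (suc j) = r j
    r⁺-inj : Injective _≡_ _~_ r⁺
    r⁺-inj {zero}  {zero}  _  = ≡.refl
    r⁺-inj {zero}  {suc j} eq = contradiction (j , ~-sym eq) new
    r⁺-inj {suc i} {zero}  eq = contradiction (i , eq) new
    r⁺-inj {suc i} {suc j} eq = ≡.cong suc (r-inj eq)

  -- The number of classes is left open here; `Finite-unique` determines it later by counting one
  -- set in two ways.
  Finite-coarsen : ∀ {_≈_ : Rel A ℓ} (≈-equiv : IsEquivalence _≈_) → (∀ {x y} → x ≈ y → x ~ y) →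
    ∀ {N} → Finite (record { isEquivalence = ≈-equiv }) N →
    ∃[ q ] Finite (record { isEquivalence = equiv }) q
  Finite-coarsen ≈-equiv ≈⇒~ I with representatives (Inverse.to I)
  ... | q , r , r-inj , covers = q , mkFinite (record { isEquivalence = equiv }) r r-inj
    λ x → map id (λ r~to → IsEquivalence.trans equiv r~to (≈⇒~ (Inverse.strictlyInverseˡ I x)))
               (covers (Inverse.from I x))

-- Finite sums and reversal of indices.

module SumProperties (M : CommutativeMonoid c ℓ) where
  open CommutativeMonoid M
  open Sum M

  -- Two enumerations differ by a permutation of indices. Hence the elements may be summed along a
  -- translate, along the cells of a square, or in permuted order.
  sum-reindex : ∀ {a ℓ′} (S : Setoid a ℓ′) {m n} (I : Finite S m) (J : Finite S n)
    (g : Setoid.Carrier S → Carrier) → (∀ {x y} → Setoid._≈_ S x y → g x ≈ g y) →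
    sum (λ i → g (Inverse.to I i)) ≈ sum (λ j → g (Inverse.to J j))
  sum-reindex S I J g g-cong =
    trans (sum-permute (λ i → g (I.to i)) π)
          (sum-cong-≋ λ j → g-cong (I.strictlyInverseˡ (J.to j)))
    where
    module I = FiniteProperties S I
    module J = FiniteProperties S J
    π = permutation (I.from ∘ J.to) (J.from ∘ I.to)
      (λ i → ≡.trans (I.from-cong (J.strictlyInverseˡ _)) (I.strictlyInverseʳ i))
      (λ j → ≡.trans (J.from-cong (I.strictlyInverseˡ _)) (J.strictlyInverseʳ j))

  sum-injective : ∀ {n} (t : Fin n → Carrier) {f : Fin n → Fin n} → Injective _≡_ _≡_ f →
    sum (t ∘ f) ≈ sum t
  sum-injective {n} t {f} inj = sum-reindex (≡.setoid (Fin n))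
    (mkFinite (≡.setoid (Fin n)) f inj (injective⇒surjective inj))
    (mkFinite (≡.setoid (Fin n)) id id (λ i → i , ≡.refl))
    t (λ { ≡.refl → refl })

  sum-combine : ∀ m {n} (f : Fin (m * n) → Carrier) →
    sum f ≈ sum (λ i → sum (λ j → f (combine {m} {n} i j)))
  sum-combine zero    f = refl
  sum-combine (suc m) {n} f = trans (sum-split n f) (∙-cong (refl) (sum-combine m (f ∘ (n ↑ʳ_))))
    where
    sum-split : ∀ k {l} (f : Fin (k + l) → Carrier) → sum f ≈ sum (f ∘ (_↑ˡ l)) ∙ sum (f ∘ (k ↑ʳ_))
    sum-split zero    f = sym (identityˡ _)
    sum-split (suc k) f = trans (∙-cong (refl) (sum-split k (f ∘ suc))) (sym (assoc _ _ _))

  sum-zero : ∀ {n} {t : Fin n → Carrier} → (∀ i → t i ≈ ε) → sum t ≈ ε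
  sum-zero {n} t≈ε = trans (sum-cong-≋ t≈ε) (sum-replicate-zero n)

opposite-sum : ∀ {n} (i : Fin n) → toℕ (opposite i) + suc (toℕ i) ≡ n
opposite-sum {n} i = ≡.trans (≡.cong (_+ suc (toℕ i)) (opposite-prop i)) (ℕ.m∸n+n≡m (toℕ<n i))

opposite-unique : ∀ {n} {i : Fin n} (j : Fin n) → toℕ j + suc (toℕ i) ≡ n → opposite i ≡ j
opposite-unique {i = i} j eq =
  toℕ-injective (ℕ.+-cancelʳ-≡ (suc (toℕ i)) _ _ (≡.trans (opposite-sum i) (≡.sym eq)))

-- Reversal acts digit by digit: mn - 1 - (ni + j) = n(m - 1 - i) + (n - 1 - j), without a borrow.
-- The antidiagonal of a block square and the reflection of a refined tile both rest on this.
opposite-combine : ∀ {m n} (i : Fin m) (j : Fin n) →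
  opposite (combine i j) ≡ combine (opposite i) (opposite j)
opposite-combine {m} {n} i j = opposite-unique (combine (opposite i) (opposite j)) (begin
  toℕ (combine (opposite i) (opposite j)) + suc (toℕ (combine i j))
    ≡⟨ ≡.cong₂ (λ x y → x + suc y) (toℕ-combine (opposite i) (opposite j)) (toℕ-combine i j) ⟩
  n * toℕ (opposite i) + toℕ (opposite j) + suc (n * toℕ i + toℕ j)
    ≡⟨ regroup (toℕ (opposite i)) (toℕ (opposite j)) (toℕ i) (toℕ j) n ⟩
  n * (toℕ (opposite i) + toℕ i) + (toℕ (opposite j) + suc (toℕ j))
    ≡⟨ ≡.cong (n * (toℕ (opposite i) + toℕ i) +_) (opposite-sum j) ⟩
  n * (toℕ (opposite i) + toℕ i) + n
    ≡⟨ factor (toℕ (opposite i)) (toℕ i) n ⟩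
  (toℕ (opposite i) + suc (toℕ i)) * n
    ≡⟨ ≡.cong (_* n) (opposite-sum i) ⟩
  m * n ∎)
  where
  open ≡.≡-Reasoning
  regroup : ∀ oi oj i j n → n * oi + oj + suc (n * i + j) ≡ n * (oi + i) + (oj + suc j)
  regroup =
    solve 5 (λ oi oj i j n → n :* oi :+ oj :+ (con 1 :+ (n :* i :+ j)) := n :* (oi :+ i) :+
      (oj :+ (con 1 :+ j))) ≡.refl
    where open +-*-Solver
  factor : ∀ oi i n → n * (oi + i) + n ≡ (oi + suc i) * n
  factor = solve 3 (λ oi i n → n :* (oi :+ i) :+ n := (oi :+ (con 1 :+ i)) :* n) ≡.refl
    where open +-*-Solver

-- Identities in abelian groups

module AbelianGroupSolver (Γ : AbelianGroup c ℓ) where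
  open AbelianGroup Γ
  open AbelianGroupProperties Γ using (∙-cancelʳ)
  open CommutativeSemigroupProperties commutativeSemigroup using (interchange)
  open SetoidReasoning setoid
  private module CM = CommutativeMonoidSolver commutativeMonoid

  infixl 6 _⊕_ _⊖_
  infix  7 ⊝_
  infix  4 _⊜_

  data Expr (n : ℕ) : Set where
    var     : Fin n → Expr n
    0′      : Expr n
    _⊕_     : Expr n → Expr n → Expr n
    ⊝_      : Expr n → Expr n

  _⊖_ : ∀ {n} → Expr n → Expr n → Expr n
  e ⊖ f = e ⊕ (⊝ f)

  _⊜_ : ∀ {n} → Expr n → Expr n → Expr n × Expr n
  _⊜_ = _,_

  ⟦_⟧ : ∀ {n} → Expr n → Vec Carrier n → Carrier
  ⟦ var i ⟧ ρ = lookup ρ i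
  ⟦ 0′ ⟧    ρ = ε
  ⟦ e ⊕ f ⟧ ρ = ⟦ e ⟧ ρ ∙ ⟦ f ⟧ ρ
  ⟦ ⊝ e ⟧   ρ = ⟦ e ⟧ ρ ⁻¹

  -- Every expression is a formal difference of `pos e` and `neg e`. An identity e = f thus becomes
  -- pos e + neg f = pos f + neg e, which contains no inverses and is decided by normal forms in a
  -- commutative monoid.
  pos neg : ∀ {n} → Expr n → CM.Expr n
  pos (var i) = CM.var i
  pos 0′      = CM.id
  pos (e ⊕ f) = pos e CM.⊕ pos f
  pos (⊝ e)   = neg e
  neg (var i) = CM.id
  neg 0′      = CM.id
  neg (e ⊕ f) = neg e CM.⊕ neg f
  neg (⊝ e)   = pos e

  split-correct : ∀ {n} (e : Expr n) ρ → ⟦ e ⟧ ρ ∙ CM.⟦ neg e ⟧ ρ ≈ CM.⟦ pos e ⟧ ρ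
  split-correct (var i) ρ = identityʳ _
  split-correct 0′      ρ = identityʳ _
  split-correct (e ⊕ f) ρ = trans (interchange _ _ _ _) (∙-cong (split-correct e ρ) (split-correct f ρ))
  split-correct (⊝ e)   ρ = begin
    ⟦ e ⟧ ρ ⁻¹ ∙ CM.⟦ pos e ⟧ ρ              ≈⟨ ∙-congˡ (split-correct e ρ) ⟨
    ⟦ e ⟧ ρ ⁻¹ ∙ (⟦ e ⟧ ρ ∙ CM.⟦ neg e ⟧ ρ)  ≈⟨ assoc _ _ _ ⟨
    ⟦ e ⟧ ρ ⁻¹ ∙ ⟦ e ⟧ ρ ∙ CM.⟦ neg e ⟧ ρ    ≈⟨ ∙-congʳ (inverseˡ _) ⟩
    ε ∙ CM.⟦ neg e ⟧ ρ                       ≈⟨ identityˡ _ ⟩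
    CM.⟦ neg e ⟧ ρ                           ∎

  close : ∀ {A : Set} n → N-ary n (Expr n) A → A
  close n f = f $ⁿ Vec.map var (allFin n)

  Solvable : ∀ {n} → Expr n × Expr n → Set
  Solvable (e , f) = True (CM.normalise (pos e CM.⊕ neg f) CM.≟ CM.normalise (pos f CM.⊕ neg e))

  group-solve : ∀ n (f : N-ary n (Expr n) (Expr n × Expr n)) {_ : Solvable (close n f)} →
          Eq n _≈_ (curryⁿ ⟦ proj₁ (close n f) ⟧) (curryⁿ ⟦ proj₂ (close n f) ⟧)
  group-solve n f {nf} = curryⁿ-cong _≈_ ⟦ e₁ ⟧ ⟦ e₂ ⟧ λ ρ →
    ∙-cancelʳ (CM.⟦ neg e₁ ⟧ ρ ∙ CM.⟦ neg e₂ ⟧ ρ) _ _ (begin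
      ⟦ e₁ ⟧ ρ ∙ (CM.⟦ neg e₁ ⟧ ρ ∙ CM.⟦ neg e₂ ⟧ ρ)  ≈⟨ assoc _ _ _ ⟨
      ⟦ e₁ ⟧ ρ ∙ CM.⟦ neg e₁ ⟧ ρ ∙ CM.⟦ neg e₂ ⟧ ρ    ≈⟨ ∙-congʳ (split-correct e₁ ρ) ⟩
      CM.⟦ pos e₁ CM.⊕ neg e₂ ⟧ ρ                     ≈⟨ CM.normalise-correct (pos e₁ CM.⊕ neg e₂) ρ ⟨
      CM.⟦ CM.normalise (pos e₁ CM.⊕ neg e₂) ⟧⇓ ρ     ≡⟨ ≡.cong (λ v → CM.⟦ v ⟧⇓ ρ) (toWitness nf) ⟩
      CM.⟦ CM.normalise (pos e₂ CM.⊕ neg e₁) ⟧⇓ ρ     ≈⟨ CM.normalise-correct (pos e₂ CM.⊕ neg e₁) ρ ⟩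
      CM.⟦ pos e₂ CM.⊕ neg e₁ ⟧ ρ                     ≈⟨ ∙-congʳ (split-correct e₂ ρ) ⟨
      ⟦ e₂ ⟧ ρ ∙ CM.⟦ neg e₂ ⟧ ρ ∙ CM.⟦ neg e₁ ⟧ ρ    ≈⟨ assoc _ _ _ ⟩
      ⟦ e₂ ⟧ ρ ∙ (CM.⟦ neg e₂ ⟧ ρ ∙ CM.⟦ neg e₁ ⟧ ρ)  ≈⟨ ∙-congˡ (comm _ _) ⟩
      ⟦ e₂ ⟧ ρ ∙ (CM.⟦ neg e₁ ⟧ ρ ∙ CM.⟦ neg e₂ ⟧ ρ)  ∎)
    where
    e₁ = proj₁ (close n f)
    e₂ = proj₂ (close n f)

  -- Brings an identity depending on one equation u = v within reach of `group-solve`: u and v are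
  -- added crosswise, which leaves an unconditional identity.
  by-hypothesis : ∀ {x y u v} → u ≈ v → x ∙ v ≈ y ∙ u → x ≈ y
  by-hypothesis {v = v} u≈v eq = ∙-cancelʳ v _ _ (trans eq (∙-congˡ u≈v))

-- Multiples and elements of prime order.

module Multiples (Γ : AbelianGroup c ℓ) where
  open AbelianGroup Γ
  open Mult commutativeMonoid public
    using (×-congʳ; ×-homo-+; ×-assocˡ; ×-distrib-+; ×-homo-1) renaming (_×_ to infixr 8 _·_)
  open SetoidReasoning setoid

  ·-zeroʳ : ∀ n → n · ε ≈ ε
  ·-zeroʳ zero    = refl
  ·-zeroʳ (suc n) = trans (identityˡ _) (·-zeroʳ n)

  ·-*-annihilate : ∀ {m x} n → m · x ≈ ε → (n * m) · x ≈ ε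
  ·-*-annihilate {m} {x} n mx≈ε = trans (sym (×-assocˡ x n m)) (trans (×-congʳ n mx≈ε) (·-zeroʳ n))

  ·-% : ∀ {p g} .{{_ : NonZero p}} → p · g ≈ ε → ∀ d → d · g ≈ toℕ (d mod p) · g
  ·-% {p} {g} pg≈ε d = begin
    d · g                               ≡⟨ ≡.cong (_· g) (m≡m%n+[m/n]*n d p) ⟩
    (d % p + d / p * p) · g             ≈⟨ ×-homo-+ g (d % p) (d / p * p) ⟩
    (d % p) · g ∙ (d / p * p) · g       ≈⟨ ∙-congˡ (·-*-annihilate (d / p) pg≈ε) ⟩
    (d % p) · g ∙ ε                     ≈⟨ identityʳ _ ⟩
    (d % p) · g                         ≡⟨ ≡.cong (_· g) (toℕ-fromℕ< (m%n<n d p)) ⟨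
    toℕ (d mod p) · g                   ∎

  Independent : ℕ → Carrier → Set ℓ
  Independent p g = ∀ (d e : Fin p) → toℕ d · g ≈ toℕ e · g → d ≡ e

module FiniteGroup (Γ : AbelianGroup c ℓ) {N : ℕ} (I : Finite (AbelianGroup.setoid Γ) N) where
  open AbelianGroup Γ
  open AbelianGroupProperties Γ using (∙-cancelˡ; identityʳ-unique)
  open Multiples Γ
  open FiniteProperties setoid I using (_≈?_)
  open Sum commutativeMonoid
  open SumProperties commutativeMonoid
  open SetoidReasoning setoid

  -- Translation by x permutes the elements, so their total is unchanged when x is added to each of
  -- the N summands.
  order-annihilates : ∀ x → N · x ≈ ε
  order-annihilates x = identityʳ-unique (sum to) (N · x) (begin
    sum to ∙ N · x                  ≈⟨ comm _ _ ⟩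
    N · x ∙ sum to                  ≈⟨ ∙-congʳ (sum-replicate N) ⟨
    sum {N} (λ _ → x) ∙ sum to      ≈⟨ ∑-distrib-+ (λ _ → x) to ⟨
    sum (λ i → x ∙ to i)            ≈⟨ sum-reindex setoid translated I id id ⟩
    sum to                          ∎)
    where
    open FiniteProperties setoid I
    x+to-injective : Injective _≡_ _≈_ (λ i → x ∙ to i)
    x+to-injective eq = to-injective (∙-cancelˡ x _ _ eq)
    translated = mkFinite setoid (λ i → x ∙ to i) x+to-injective (injective⇒onto x+to-injective)

  PrimeOrder : ℕ → Carrier → Set ℓ
  PrimeOrder p g = Prime p × ¬ g ≈ ε × p · g ≈ ε

  -- Descent on a number r that kills x: if r = qd is composite, either d already kills x, or dx is
  -- nonzero and killed by q. Both factors are smaller than r.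
  prime-order : ∀ {r x} → Acc _<_ r → .{{NonZero r}} → ¬ x ≈ ε → r · x ≈ ε → ∃[ p ] ∃[ g ] PrimeOrder p g
  prime-order {suc zero} _ x≉ε rx≈ε = contradiction (trans (sym (×-homo-1 _)) rx≈ε) x≉ε
  prime-order {r@(suc (suc _))} {x} (acc rec) x≉ε rx≈ε with prime? r
  ... | yes r-prime = r , x , r-prime , x≉ε , rx≈ε
  ... | no ¬r-prime with ¬prime⇒composite ¬r-prime
  ... | composite {d} d<r d∣r@(divides q r≡q*d) with (d · x) ≈? ε
  ...   | yes dx≈ε = prime-order (rec d<r) {{nonTrivial⇒nonZero d}} x≉ε dx≈ε
  ...   | no  dx≉ε =
    prime-order (rec (quotient-< d∣r)) {{quotient≢0 d∣r}} dx≉ε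
      (trans (×-assocˡ x q d) (trans (reflexive (≡.cong (_· x) (≡.sym r≡q*d))) rx≈ε))

  -- If two multiples below p agreed, some kg with 0 < k < p would vanish; Bézout's identity for k
  -- and p then forces g = 0.
  primeOrder⇒independent : ∀ {p g} → PrimeOrder p g → Independent p g
  primeOrder⇒independent {p} {g} (p-prime , g≉ε , pg≈ε) d e eq = case ℕ.<-cmp (toℕ d) (toℕ e) of λ where
      (tri≈ _ d≡e _) → toℕ-injective d≡e
      (tri< d<e _ _) → contradiction (sym eq) (distinct d<e (toℕ<n e))
      (tri> _ _ e<d) → contradiction eq (distinct e<d (toℕ<n d))
    where
    kills-g : ∀ {m n} → 1 + m ≡ n → m · g ≈ ε → n · g ≈ ε → g ≈ ε
    kills-g ≡.refl mg≈ε ng≈ε = trans (sym (identityʳ g)) (trans (∙-congˡ (sym mg≈ε)) ng≈ε)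

    no-smaller-order : ∀ k → .{{_ : NonZero k}} → k < p → ¬ k · g ≈ ε
    no-smaller-order k k<p kg≈ε with coprime-Bézout (prime⇒coprime p-prime k<p)
    ... | Bézout.+- x y 1+yk≡xp = g≉ε (kills-g 1+yk≡xp (·-*-annihilate y kg≈ε) (·-*-annihilate x pg≈ε))
    ... | Bézout.-+ x y 1+xp≡yk = g≉ε (kills-g 1+xp≡yk (·-*-annihilate x pg≈ε) (·-*-annihilate y kg≈ε))

    distinct : ∀ {m n} → m < n → n < p → ¬ n · g ≈ m · g
    distinct {m} {n} m<n n<p eq = no-smaller-order (n ∸ m) {{>-nonZero (ℕ.m<n⇒0<n∸m m<n)}}
      (ℕ.≤-<-trans (ℕ.m∸n≤m n m) n<p)
      (identityʳ-unique (m · g) _ (begin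
        m · g ∙ (n ∸ m) · g   ≈⟨ ×-homo-+ g m (n ∸ m) ⟨
        (m + (n ∸ m)) · g     ≡⟨ ≡.cong (_· g) (ℕ.m+[n∸m]≡n (ℕ.<⇒≤ m<n)) ⟩
        n · g                 ≈⟨ eq ⟩
        m · g                 ∎))

-- Quotients

-- A subgroup is given by its coset relation. The quotient keeps the carrier and operations of Γ, so
-- that choosing a representative is the identity map and only equality becomes coarser.
record Congruence (Γ : AbelianGroup c ℓ) : Set (c ⊔ lsuc ℓ) where
  open AbelianGroup Γ using (Carrier; _≈_; _∙_; ε; _⁻¹; assoc; comm; identityˡ; identityʳ; inverseˡ;
    inverseʳ)
  infix 4 _~_
  field
    _~_           : Rel Carrier ℓ
    isEquivalence : IsEquivalence _~_
    ≈⇒~           : ∀ {x y} → x ≈ y → x ~ y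
    ∙-cong        : ∀ {w x y z} → w ~ x → y ~ z → w ∙ y ~ x ∙ z

  open IsEquivalence isEquivalence public renaming (reflexive to ~-reflexive; refl to ~-refl; sym to ~-sym;
    trans to ~-trans)

  private
    ⁻¹-cong : ∀ {x y} → x ~ y → x ⁻¹ ~ y ⁻¹
    ⁻¹-cong {x} {y} x~y =
      ~-trans (≈⇒~ (group-solve 2 (λ a b → ⊝ a ⊜ b ⊕ (⊝ a ⊖ b)) x y))
     (~-trans (∙-cong (~-sym x~y) ~-refl)
              (≈⇒~ (group-solve 2 (λ a b → a ⊕ (⊝ a ⊖ b) ⊜ ⊝ b) x y)))
      where open AbelianGroupSolver Γ

  quotient : AbelianGroup c ℓ
  quotient = record
    { _≈_ = _~_ ; _∙_ = _∙_ ; ε = ε ; _⁻¹ = _⁻¹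
    ; isAbelianGroup = record
      { isGroup = record
        { isMonoid = record
          { isSemigroup = record
            { isMagma = record { isEquivalence = isEquivalence ; ∙-cong = ∙-cong }
            ; assoc = λ x y z → ≈⇒~ (assoc x y z) }
          ; identity = ≈⇒~ ∘ identityˡ , ≈⇒~ ∘ identityʳ }
        ; inverse = ≈⇒~ ∘ inverseˡ , ≈⇒~ ∘ inverseʳ
        ; ⁻¹-cong = ⁻¹-cong }
      ; comm = λ x y → ≈⇒~ (comm x y) } }

module _ {Γ : AbelianGroup c ℓ} (C : Congruence Γ) where
  open AbelianGroup Γ using (Carrier)
  private
    module Γ = Multiples Γ
    module Q = Multiples (Congruence.quotient C)

  quotient-· : ∀ n x → n Q.· x ≡ n Γ.· x
  quotient-· zero    x = ≡.refl
  quotient-· (suc n) x = ≡.cong (AbelianGroup._∙_ Γ x) (quotient-· n x)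

trivial : (Γ : AbelianGroup c ℓ) → Congruence Γ
trivial Γ = record { _~_ = _≈_ ; isEquivalence = isEquivalence ; ≈⇒~ = id ; ∙-cong = ∙-cong }
  where open AbelianGroup Γ

module Adjoin {Γ : AbelianGroup c ℓ} (C : Congruence Γ) (g : AbelianGroup.Carrier Γ)
  (p : ℕ) (p≢0 : NonZero p) (pg~ε : Congruence._~_ C (Multiples._·_ Γ p g) (AbelianGroup.ε Γ)) where

  open AbelianGroup Γ using (Carrier; _∙_; ε)
  open Congruence C
  open AbelianGroup quotient using (refl; sym; trans; assoc; ∙-congˡ; ∙-congʳ; setoid)
  open Multiples Γ using (_·_)
  private module Q = Multiples quotient
  open AbelianGroupSolver quotient using (group-solve; _⊕_; _⊜_; 0′)
  open AbelianGroupProperties quotient using (∙-cancelˡ)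
  open SetoidReasoning setoid
  private instance _ = p≢0

  infix 4 _~⁺_
  -- Natural multiples suffice, since pg = 0 modulo C turns -dg into (p - 1)dg.
  _~⁺_ : Rel Carrier ℓ
  x ~⁺ y = ∃[ d ] x ~ y ∙ d · g

  ·-+ : ∀ m n → (m + n) · g ~ m · g ∙ n · g
  ·-+ m n = ≈⇒~ (Multiples.×-homo-+ Γ g m n)

  private
    p-fold : p Q.· g ~ ε
    p-fold = trans (~-reflexive (quotient-· C p g)) pg~ε

  -- Stated with `suc (pred p)` because `suc (pred p) * d` unfolds to `d + pred p * d`, the
  -- coefficient that arises in the symmetry of `_~⁺_`.
  annihilated : ∀ d → (suc (pred p) * d) · g ~ ε
  annihilated d = begin
    (suc (pred p) * d) · g    ≡⟨ ≡.cong (_· g) (≡.trans (≡.cong (_* d) (ℕ.suc-pred p)) (ℕ.*-comm p d)) ⟩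
    (d * p) · g               ≡⟨ quotient-· C (d * p) g ⟨
    (d * p) Q.· g             ≈⟨ Q.·-*-annihilate d p-fold ⟩
    ε                         ∎

  adjoin : Congruence Γ
  adjoin = record
    { _~_ = _~⁺_
    ; isEquivalence = record
      { refl  = 0 , group-solve 1 (λ x → x ⊜ x ⊕ 0′) _
      ; sym   = λ {x} {y} (d , x~y+dg) → pred p * d , sym (begin
          x ∙ (pred p * d) · g              ≈⟨ ∙-congʳ x~y+dg ⟩
          y ∙ d · g ∙ (pred p * d) · g      ≈⟨ assoc _ _ _ ⟩
          y ∙ (d · g ∙ (pred p * d) · g)    ≈⟨ ∙-congˡ (·-+ d (pred p * d)) ⟨
          y ∙ (suc (pred p) * d) · g        ≈⟨ ∙-congˡ (annihilated d) ⟩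
          y ∙ ε                             ≈⟨ group-solve 1 (λ y → y ⊕ 0′ ⊜ y) y ⟩
          y                                 ∎)
      ; trans = λ {x} {y} {z} (d , x~y+dg) (e , y~z+eg) → e + d , (begin
          x                        ≈⟨ x~y+dg ⟩
          y ∙ d · g                ≈⟨ ∙-congʳ y~z+eg ⟩
          z ∙ e · g ∙ d · g        ≈⟨ assoc _ _ _ ⟩
          z ∙ (e · g ∙ d · g)      ≈⟨ ∙-congˡ (·-+ e d) ⟨
          z ∙ (e + d) · g          ∎)
      }
    ; ≈⇒~ = λ x≈y → 0 , trans (≈⇒~ x≈y) (group-solve 1 (λ x → x ⊜ x ⊕ 0′) _)
    ; ∙-cong = λ {w} {x} {y} {z} (d , w~x+dg) (e , y~z+eg) → d + e , (begin
          w ∙ y                            ≈⟨ ∙-cong w~x+dg y~z+eg ⟩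
          (x ∙ d · g) ∙ (z ∙ e · g)        ≈⟨ group-solve 4
            (λ x a z b → (x ⊕ a) ⊕ (z ⊕ b) ⊜ (x ⊕ z) ⊕ (a ⊕ b)) x (d · g) z (e · g) ⟩
          (x ∙ z) ∙ (d · g ∙ e · g)        ≈⟨ ∙-congˡ (·-+ d e) ⟨
          (x ∙ z) ∙ (d + e) · g            ∎)
    }

  ~⇒~⁺ : ∀ {x y} → x ~ y → x ~⁺ y
  ~⇒~⁺ x~y = 0 , trans x~y (group-solve 1 (λ x → x ⊜ x ⊕ 0′) _)

  ~⁺-reduce : ∀ {x y} d e → x ∙ d · g ~ y ∙ e · g → x ~⁺ y
  ~⁺-reduce d e eq = ~⁺-trans (~⁺-sym (d , refl)) (~⁺-trans (~⇒~⁺ eq) (e , refl))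
    where open Congruence adjoin using () renaming (~-sym to ~⁺-sym; ~-trans to ~⁺-trans)

  bounded : ∀ {x y} → x ~⁺ y → ∃[ d ] x ~ y ∙ toℕ {p} d · g
  bounded {x} {y} (d , x~y+dg) = d mod p , trans x~y+dg (∙-congˡ (begin
    d · g                    ≡⟨ quotient-· C d g ⟨
    d Q.· g                  ≈⟨ Q.·-% p-fold d ⟩
    toℕ (d mod p) Q.· g      ≡⟨ quotient-· C (toℕ (d mod p)) g ⟩
    toℕ (d mod p) · g        ∎))

  Independent : Set ℓ
  Independent = ∀ (d e : Fin p) → toℕ d · g ~ toℕ e · g → d ≡ e

  module _ {N : ℕ} (I : Finite setoid N) where
    open FiniteProperties setoid I using (_≈?_)

    _~⁺?_ : Decidable _~⁺_
    x ~⁺? y = map′ (λ (d , eq) → toℕ d , eq) bounded (any? (λ d → x ≈? (y ∙ toℕ {p} d · g)))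

    module _ (independent : Independent) where
      cosets : ∃[ q ] Finite (AbelianGroup.setoid (Congruence.quotient adjoin)) q
      cosets = Finite-coarsen (Congruence.isEquivalence adjoin) _~⁺?_ isEquivalence ~⇒~⁺ I

      -- Each element is a coset representative plus a unique multiple of g below p; counting these
      -- pairs gives Lagrange's formula.
      index : proj₁ cosets * p ≡ N
      index = Finite-unique setoid (mkFinite-× setoid f f-injective f-onto) I
        where
        module J = FiniteProperties (AbelianGroup.setoid (Congruence.quotient adjoin)) (proj₂ cosets)
        open Congruence adjoin using () renaming (~-sym to ~⁺-sym)
        f : Fin (proj₁ cosets) → Fin p → Carrier
        f c d = J.to c ∙ toℕ d · g
        f-injective : ∀ {c c′ d d′} → f c d ~ f c′ d′ → c ≡ c′ × d ≡ d′
        f-injective {c} {c′} {d} {d′} eq = c≡c′ , independent d d′ (∙-cancelˡ (J.to c) _ _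
          (trans eq (∙-congʳ (~-reflexive (≡.cong J.to (≡.sym c≡c′))))))
          where
          c≡c′ : c ≡ c′
          c≡c′ = J.to-injective (~⁺-reduce (toℕ d) (toℕ d′) eq)
        f-onto : ∀ x → ∃[ c ] ∃[ d ] f c d ~ x
        f-onto x = let (d , eq) = bounded (~⁺-sym (J.strictlyInverseˡ x)) in J.from x , d , sym eq

module _ {Γ : AbelianGroup c ℓ} (C : Congruence Γ) where
  open Congruence C using (quotient; _~_; ~-reflexive; ~-trans; ~-sym)
  open AbelianGroup Γ using (Carrier; _∙_; ε)
  open Multiples Γ using (_·_)

  -- A coarser congruence C⁺ whose classes consist of p classes of C, differing by multiples of g.
  record PrimeAdjunction (N : ℕ) : Set (c ⊔ lsuc ℓ) where
    field
      p           : ℕ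
      p-prime     : Prime p
      g           : Carrier
      C⁺          : Congruence Γ
    open Congruence C⁺ using () renaming (_~_ to _~⁺_; quotient to quotient⁺)
    field
      ~⁺-reduce   : ∀ {x y} d e → x ∙ d · g ~ y ∙ e · g → x ~⁺ y
      bounded     : ∀ {x y} → x ~⁺ y → ∃[ d ] x ~ y ∙ toℕ {p} d · g
      independent : ∀ (d e : Fin p) → toℕ d · g ~ toℕ e · g → d ≡ e
      q           : ℕ
      coset-count : Finite (AbelianGroup.setoid quotient⁺) q
      q*p≡N       : q * p ≡ N

  module _ {N} (I : Finite (AbelianGroup.setoid quotient) N) where
    private
      PrimeOrder : ℕ → Carrier → Set ℓ
      PrimeOrder = FiniteGroup.PrimeOrder quotient I

    adjoin-primeOrder : ∀ {p g} → PrimeOrder p g → PrimeAdjunction N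
    adjoin-primeOrder {p} {g} order@(p-prime , _ , pg~ε) = record
      { p-prime = p-prime
      ; g = g
      ; C⁺ = Adjoin.adjoin C g p p≢0 p·g~ε
      ; ~⁺-reduce = Adjoin.~⁺-reduce C g p p≢0 p·g~ε
      ; bounded = Adjoin.bounded C g p p≢0 p·g~ε
      ; independent = independent
      ; coset-count = proj₂ (Adjoin.cosets C g p p≢0 p·g~ε I independent)
      ; q*p≡N = Adjoin.index C g p p≢0 p·g~ε I independent }
      where
      p≢0 = prime⇒nonZero p-prime
      p·g~ε : p · g ~ ε
      p·g~ε = ~-trans (~-reflexive (≡.sym (quotient-· C p g))) pg~ε
      independent : ∀ (d e : Fin p) → toℕ d · g ~ toℕ e · g → d ≡ e
      independent d e eq = FiniteGroup.primeOrder⇒independent quotient I order d e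
        (~-trans (~-reflexive (quotient-· C (toℕ d) g))
          (~-trans eq (~-reflexive (≡.sym (quotient-· C (toℕ e) g)))))

    nontrivial-element : 1 < N → ∃[ x ] ¬ x ~ ε
    nontrivial-element (s≤s (s≤s _)) = case to zero ≈? ε of λ where
        (no  0≁ε) → _ , 0≁ε
        (yes 0~ε) → to (suc zero) , λ 1~ε → case to-injective (~-trans 0~ε (~-sym 1~ε)) of λ ()
      where open FiniteProperties (AbelianGroup.setoid quotient) I using (to; to-injective; _≈?_)

    abstract
      primeAdjunction : 1 < N → PrimeAdjunction N
      primeAdjunction 1<N =
        let (x , x≁ε) = nontrivial-element 1<N
            (_ , _ , order) = FiniteGroup.prime-order quotient I (<-wellFounded N)
              {{>-nonZero (ℕ.<-trans (s≤s z≤n) 1<N)}} x≁ε (FiniteGroup.order-annihilates quotient I x)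
        in adjoin-primeOrder order

-- Tilings by two symmetric sets.

-- The symmetry of the two tiles is exact, although they tile Γ only modulo C.
record Tiling {Γ : AbelianGroup c ℓ} (C : Congruence Γ) (a b : ℕ) : Set (c ⊔ ℓ) where
  open AbelianGroup Γ using (Carrier; _∙_; _≈_)
  open Congruence C using (_~_)
  field
    T           : Fin a → Carrier
    H           : Fin b → Carrier
    τ η         : Carrier
    T-symmetric : ∀ i → T i ∙ T (opposite i) ≈ τ
    H-symmetric : ∀ j → H j ∙ H (opposite j) ≈ η
    unique      : ∀ {i i′ j j′} → T i ∙ H j ~ T i′ ∙ H j′ → i ≡ i′ × j ≡ j′
    covers      : ∀ x → ∃[ i ] ∃[ j ] T i ∙ H j ~ x

module _ {Γ : AbelianGroup c ℓ} where
  open AbelianGroup Γ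
  open AbelianGroupSolver Γ using (group-solve; _⊕_; _⊜_)
  open Multiples Γ

  swap-tiling : ∀ {C : Congruence Γ} {a b} → Tiling C a b → Tiling C b a
  swap-tiling {C} t = record
    { T = H ; H = T ; τ = η ; η = τ ; T-symmetric = H-symmetric ; H-symmetric = T-symmetric
    ; unique = λ eq → swap (unique (~-trans (≈⇒~ (comm _ _)) (~-trans eq (≈⇒~ (comm _ _)))))
    ; covers = λ x → let (i , j , eq) = covers x in j , i , ~-trans (≈⇒~ (comm _ _)) eq
    }
    where
    open Tiling t
    open Congruence C using (≈⇒~; ~-trans)

  singleton-tiling : ∀ {C : Congruence Γ} → Finite (AbelianGroup.setoid (Congruence.quotient C)) 1 →
    Tiling C 1 1
  singleton-tiling {C} I = record
    { T = λ _ → ε ; H = λ _ → ε ; τ = ε ∙ ε ; η = ε ∙ ε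
    ; T-symmetric = λ _ → refl ; H-symmetric = λ _ → refl
    ; unique = λ { {zero} {zero} {zero} {zero} _ → ≡.refl , ≡.refl }
    ; covers = λ x → zero , zero , from-injective (one (from (ε ∙ ε)) (from x))
    }
    where
    open FiniteProperties (AbelianGroup.setoid (Congruence.quotient C)) I
    one : (i j : Fin 1) → i ≡ j
    one zero zero = ≡.refl

  -- Each t in T becomes the progression t, t + g, ..., t + (p - 1)g, which meets every class of C
  -- inside the C⁺-class of t once. Reversing the progression is a reflection, so the new constant
  -- is τ + (p - 1)g. Symmetry known only modulo C⁺ would not give symmetry modulo C; hence its
  -- exact form.
  refine-tiling : ∀ {C : Congruence Γ} {N a b} (A : PrimeAdjunction C N) →
    Tiling (PrimeAdjunction.C⁺ A) a b → Tiling C (a * PrimeAdjunction.p A) b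
  refine-tiling {C} {N} {a} {b} A t = record
    { T = uncurry T⁺ ∘ remQuot {a} p
    ; H = t.H ; η = t.η ; H-symmetric = t.H-symmetric
    ; τ = t.τ ∙ pred p · g
    ; T-symmetric = T⁺-symmetric
    ; unique = λ {k} {k′} {j} {j′} eq →
        let (c≡c′ , d≡d′ , j≡j′) = T⁺-unique eq in
        ≡.trans (≡.sym (combine-remQuot {a} p k))
          (≡.trans (≡.cong₂ combine c≡c′ d≡d′) (combine-remQuot {a} p k′)) , j≡j′
    ; covers = λ x → let (c , j , x~⁺) = t.covers x
                         (d , x~) = bounded (Congruence.~-sym C⁺ x~⁺) in
        combine c d , j ,
        ~-trans (~-reflexive (≡.cong (λ k → uncurry T⁺ k ∙ t.H j) (remQuot-combine c d)))
          (~-trans (≈⇒~ (exchange _ _ _)) (~-sym x~))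
    }
    where
    module t = Tiling t
    open PrimeAdjunction A using (p; g; C⁺; bounded; independent; ~⁺-reduce)
    open Congruence C using (_~_; quotient; ≈⇒~; ~-sym; ~-trans; ~-reflexive)
    open SetoidReasoning setoid
    T⁺ : Fin a → Fin p → Carrier
    T⁺ c d = t.T c ∙ toℕ d · g

    exchange : ∀ x y z → (x ∙ y) ∙ z ≈ (x ∙ z) ∙ y
    exchange = group-solve 3 (λ x y z → (x ⊕ y) ⊕ z ⊜ (x ⊕ z) ⊕ y)

    T⁺-unique : ∀ {c c′ d d′ j j′} → T⁺ c d ∙ t.H j ~ T⁺ c′ d′ ∙ t.H j′ → c ≡ c′ × d ≡ d′ × j ≡ j′
    T⁺-unique {d = d} {d′} eq
      with eq′ ← ~-trans (≈⇒~ (exchange _ _ _)) (~-trans eq (≈⇒~ (exchange _ _ _)))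
      with ≡.refl , ≡.refl ← t.unique (~⁺-reduce (toℕ d) (toℕ d′) eq′)
      = ≡.refl , independent d d′ (AbelianGroupProperties.∙-cancelˡ quotient _ _ _ eq′) , ≡.refl

    complementary : ∀ (d : Fin p) → toℕ d + toℕ (opposite d) ≡ pred p
    complementary d = ≡.cong pred (≡.trans (≡.cong suc (ℕ.+-comm (toℕ d) _))
      (≡.trans (≡.sym (ℕ.+-suc _ _)) (opposite-sum d)))

    T⁺-symmetric : ∀ k →
      uncurry T⁺ (remQuot {a} p k) ∙ uncurry T⁺ (remQuot {a} p (opposite k)) ≈ t.τ ∙ pred p · g
    T⁺-symmetric k = let (c , d) = remQuot {a} p k in begin
      T⁺ c d ∙ uncurry T⁺ (remQuot {a} p (opposite k))
        ≡⟨ ≡.cong (λ k → T⁺ c d ∙ uncurry T⁺ (remQuot {a} p (opposite k))) (combine-remQuot {a} p k) ⟨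
      T⁺ c d ∙ uncurry T⁺ (remQuot {a} p (opposite (combine c d)))
        ≡⟨ ≡.cong (λ k → T⁺ c d ∙ uncurry T⁺ (remQuot {a} p k)) (opposite-combine c d) ⟩
      T⁺ c d ∙ uncurry T⁺ (remQuot {a} p (combine (opposite c) (opposite d)))
        ≡⟨ ≡.cong (λ k → T⁺ c d ∙ uncurry T⁺ k) (remQuot-combine (opposite c) (opposite d)) ⟩
      (t.T c ∙ toℕ d · g) ∙ (t.T (opposite c) ∙ toℕ (opposite d) · g)
        ≈⟨ group-solve 4 (λ x y z w → (x ⊕ y) ⊕ (z ⊕ w) ⊜ (x ⊕ z) ⊕ (y ⊕ w)) (t.T c) _ _ _ ⟩
      (t.T c ∙ t.T (opposite c)) ∙ (toℕ d · g ∙ toℕ (opposite d) · g)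
        ≈⟨ ∙-cong (sym (t.T-symmetric c)) (×-homo-+ g (toℕ d) (toℕ (opposite d))) ⟨
      t.τ ∙ (toℕ d + toℕ (opposite d)) · g
        ≡⟨ ≡.cong (λ n → t.τ ∙ n · g) (complementary d) ⟩
      t.τ ∙ pred p · g ∎

  module _ {C : Congruence Γ} {N : ℕ} (A : PrimeAdjunction C N) where
    open PrimeAdjunction A

    index-decreases : .{{_ : NonZero N}} → q < N
    index-decreases = ≡.subst (q <_) q*p≡N (ℕ.m<m*n q p
      {{≢-nonZero λ q≡0 → ≢-nonZero⁻¹ N (≡.trans (≡.sym q*p≡N) (≡.cong (_* p) q≡0))}}
      (nonTrivial⇒n>1 p {{prime⇒nonTrivial p-prime}}))

    -- By Euclid's lemma p divides a or b, and the corresponding tile absorbs the multiples of g.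
    lift-tiling : (∀ a b → a * b ≡ q → Tiling C⁺ a b) → ∀ a b → a * b ≡ N → Tiling C a b
    lift-tiling IH a b ab≡N =
      case euclidsLemma a b p-prime (divides q (≡.trans ab≡N (≡.sym q*p≡N))) of λ where
        (inj₁ (divides a′ ≡.refl)) → refine-tiling A (IH a′ b (cancel-p (≡.trans (shuffle a′ b p) ab≡N)))
        (inj₂ (divides b′ ≡.refl)) → swap-tiling (refine-tiling A (swap-tiling
          (IH a b′ (cancel-p (≡.trans (ℕ.*-assoc a b′ p) ab≡N)))))
      where
      shuffle : ∀ a b p → a * b * p ≡ a * p * b
      shuffle = solve 3 (λ a b p → a :* b :* p := a :* p :* b) ≡.refl
        where open +-*-Solver
      cancel-p : ∀ {m} → m * p ≡ N → m ≡ q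
      cancel-p mp≡N = ℕ.*-cancelʳ-≡ _ q p {{prime⇒nonZero p-prime}} (≡.trans mp≡N (≡.sym q*p≡N))

  tiling-rec : ∀ {N} → Acc _<_ N → ∀ {C : Congruence Γ} a b → a * b ≡ N →
    Finite (AbelianGroup.setoid (Congruence.quotient C)) N → Tiling C a b
  tiling-rec {zero} _ a b ab≡0 I = case Inverse.from I ε of λ ()
  tiling-rec {suc zero} _ {C} a b ab≡1 I
    with ≡.refl ← ℕ.m*n≡1⇒m≡1 a b ab≡1 | ≡.refl ← ℕ.m*n≡1⇒n≡1 a b ab≡1 = singleton-tiling {C} I
  tiling-rec {N@(suc (suc _))} (acc rec) {C} a b ab≡N I =
    lift-tiling A
      (λ a b ab≡q → tiling-rec (rec (index-decreases A)) a b ab≡q (PrimeAdjunction.coset-count A)) a b ab≡N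
    where
    A : PrimeAdjunction C N
    A = primeAdjunction C I (s≤s (s≤s z≤n))

  abstract
    tiling : ∀ {C : Congruence Γ} a b →
      Finite (AbelianGroup.setoid (Congruence.quotient C)) (a * b) → Tiling C a b
    tiling a b I = tiling-rec (<-wellFounded _) a b ≡.refl I

-- Odd side

-- Constructions have only distinctness to check: n² distinct entries in a group of order n² exhaust
-- it.
record ZeroSumArray (Γ : AbelianGroup c ℓ) (n : ℕ) : Set (c ⊔ ℓ) where
  open AbelianGroup Γ using (Carrier; _≈_; ε; commutativeMonoid)
  open Sum commutativeMonoid using (sum)
  field
    entry        : Fin n → Fin n → Carrier
    distinct     : ∀ {i i′ j j′} → entry i j ≈ entry i′ j′ → i ≡ i′ × j ≡ j′
    row-sum      : ∀ i → sum (λ j → entry i j) ≈ ε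
    column-sum   : ∀ j → sum (λ i → entry i j) ≈ ε
    diagonal     : sum (λ i → entry i i) ≈ ε
    antidiagonal : sum (λ i → entry i (opposite i)) ≈ ε

toMagicSquare : ∀ {Γ : AbelianGroup c ℓ} {n} → HasOrder Γ (n ^ 2) → ZeroSumArray Γ n →
  ∃[ S ] ZeroSum {Γ = Γ} {n = n} S
toMagicSquare {Γ = Γ} {n} I A = record
  { entry = entry ; μ = ε
  ; each-once = λ g → let (k , eq) = I.injective⇒onto flat-injective g in
      remQuot {n} n k , eq , λ eq′ → let (i≡ , j≡) = distinct (trans eq (sym eq′)) in ≡.cong₂ _,_ i≡ j≡
  ; row-sum = row-sum ; column-sum = column-sum ; diagonal = diagonal ; antidiagonal = antidiagonal
  } , refl
  where
  open AbelianGroup Γ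
  open ZeroSumArray A
  module I = FiniteProperties setoid (≡.subst (Finite setoid) (≡.cong (n *_) (ℕ.*-identityʳ n)) I)
  flat-injective : Injective _≡_ _≈_ (uncurry entry ∘ remQuot {n} n)
  flat-injective {k} {l} eq = let (i≡ , j≡) = distinct eq in
    ≡.trans (≡.sym (combine-remQuot {n} n k)) (≡.trans (≡.cong₂ combine i≡ j≡) (combine-remQuot {n} n l))

module _ (Γ : AbelianGroup c ℓ) where
  open AbelianGroup Γ
  open Sum commutativeMonoid
  open SumProperties commutativeMonoid

  -- The diagonals are constrained by sums and not by injectivity of `L` and `M`, because in the
  -- cyclic construction one of the two squares is constant on each diagonal.
  latinArray : ∀ {n} (T H : Fin n → Carrier) (L M : Fin n → Fin n → Fin n) →
    (∀ {i i′ j j′} → T i ∙ H j ≈ T i′ ∙ H j′ → i ≡ i′ × j ≡ j′) →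
    (∀ {i i′ j j′} → L i j ≡ L i′ j′ → M i j ≡ M i′ j′ → i ≡ i′ × j ≡ j′) →
    (∀ {i j j′} → L i j ≡ L i j′ → j ≡ j′) → (∀ {i i′ j} → L i j ≡ L i′ j → i ≡ i′) →
    (∀ {i j j′} → M i j ≡ M i j′ → j ≡ j′) → (∀ {i i′ j} → M i j ≡ M i′ j → i ≡ i′) →
    sum T ≈ ε → sum H ≈ ε →
    sum (λ i → T (L i i)) ≈ ε → sum (λ i → H (M i i)) ≈ ε →
    sum (λ i → T (L i (opposite i))) ≈ ε → sum (λ i → H (M i (opposite i))) ≈ ε →
    ZeroSumArray Γ n
  latinArray {n} T H L M tiles orthogonal L-row L-col M-row M-col ΣT ΣH dT dH aT aH = record
    { entry = λ i j → T (L i j) ∙ H (M i j)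
    ; distinct = λ eq → let (L≡ , M≡) = tiles eq in orthogonal L≡ M≡
    ; row-sum = λ i → both (trans (sum-injective T L-row) ΣT) (trans (sum-injective H M-row) ΣH)
    ; column-sum = λ j → both (trans (sum-injective T L-col) ΣT) (trans (sum-injective H M-col) ΣH)
    ; diagonal = both dT dH
    ; antidiagonal = both aT aH
    }
    where
    both : ∀ {t h : Fin n → Carrier} → sum t ≈ ε → sum h ≈ ε → sum (λ i → t i ∙ h i) ≈ ε
    both {t} {h} Σt Σh = trans (∑-distrib-+ t h) (trans (∙-cong Σt Σh) (identityˡ ε))

opposite-injective : ∀ {n} {i j : Fin n} → opposite i ≡ opposite j → i ≡ j
opposite-injective {_} {i} {j} eq =
  ≡.trans (≡.sym (opposite-involutive i)) (≡.trans (≡.cong opposite eq) (opposite-involutive j))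

-- A Latin square orthogonal to its left-right mirror image. `L` is constant on the antidiagonal and
-- its mirror image on the main diagonal, so the constant must be an index where both tiles can be
-- made to vanish: the fixed point `mid` of reversal.
record MirrorOrthogonal (n : ℕ) : Set where
  field
    L               : Fin n → Fin n → Fin n
    mid             : Fin n
    opposite-mid    : opposite mid ≡ mid
    row-injective   : ∀ {i j j′} → L i j ≡ L i j′ → j ≡ j′
    column-injective : ∀ {i i′ j} → L i j ≡ L i′ j → i ≡ i′
    diagonal-injective : ∀ {i i′} → L i i ≡ L i′ i′ → i ≡ i′
    antidiagonal    : ∀ i → L i (opposite i) ≡ mid
    orthogonal      : ∀ {i i′ j j′} → L i j ≡ L i′ j′ → L i (opposite j) ≡ L i′ (opposite j′) →
      i ≡ i′ × j ≡ j′

module CyclicSquare (k : ℕ) where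
  private
    n : ℕ
    n = suc (k + k)

  infix 4 _≋_
  _≋_ : ℕ → ℕ → Set
  x ≋ y = x % n ≡ y % n

  ≋-+ : ∀ {w x y z} → w ≋ x → y ≋ z → w + y ≋ x + z
  ≋-+ {w} {x} {y} {z} w≋x y≋z = ≡.trans (%-distribˡ-+ w y n)
    (≡.trans (≡.cong₂ (λ a b → (a + b) % n) w≋x y≋z) (≡.sym (%-distribˡ-+ x z n)))

  ≋-*ˡ : ∀ m {x y} → x ≋ y → m * x ≋ m * y
  ≋-*ˡ zero    x≋y = ≡.refl
  ≋-*ˡ (suc m) {x} {y} x≋y = ≋-+ {x} {y} {m * x} {m * y} x≋y (≋-*ˡ m x≋y)

  -- Adding 2k further copies of c completes it to cn, which vanishes modulo n.
  ≋-cancelʳ : ∀ c {x y} → x + c ≋ y + c → x ≋ y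
  ≋-cancelʳ c {x} {y} eq = begin
    x % n                        ≡⟨ [m+kn]%n≡m%n x c n ⟨
    (x + c * n) % n              ≡⟨ ≡.cong (_% n) (split x c (k + k)) ⟩
    (x + c + c * (k + k)) % n    ≡⟨ ≋-+ {x + c} {y + c} {c * (k + k)} eq ≡.refl ⟩
    (y + c + c * (k + k)) % n    ≡⟨ ≡.cong (_% n) (split y c (k + k)) ⟨
    (y + c * n) % n              ≡⟨ [m+kn]%n≡m%n y c n ⟩
    y % n                        ∎
    where
    open ≡.≡-Reasoning
    split : ∀ x c m → x + c * suc m ≡ x + c + c * m
    split = solve 3 (λ x c m → x :+ c :* (con 1 :+ m) := x :+ c :+ c :* m) ≡.refl
      where open +-*-Solver

  -- k + 1 is the inverse of 2 modulo n = 2k + 1.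
  ≋-halve : ∀ {x y} → x + x ≋ y + y → x ≋ y
  ≋-halve {x} {y} eq = begin
    x % n                        ≡⟨ [m+kn]%n≡m%n x x n ⟨
    (x + x * n) % n              ≡⟨ ≡.cong (_% n) (double k x) ⟨
    (suc k * (x + x)) % n        ≡⟨ ≋-*ˡ (suc k) {x + x} {y + y} eq ⟩
    (suc k * (y + y)) % n        ≡⟨ ≡.cong (_% n) (double k y) ⟩
    (y + y * n) % n              ≡⟨ [m+kn]%n≡m%n y y n ⟩
    y % n                        ∎
    where
    open ≡.≡-Reasoning
    double : ∀ k x → suc k * (x + x) ≡ x + x * suc (k + k)
    double = solve 2 (λ k x → (con 1 :+ k) :* (x :+ x) := x :+ x :* (con 1 :+ (k :+ k))) ≡.refl
      where open +-*-Solver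

  mod-injective : ∀ x y → x mod n ≡ y mod n → x ≋ y
  mod-injective x y eq =
    ≡.trans (≡.sym (toℕ-fromℕ< (m%n<n x n))) (≡.trans (≡.cong toℕ eq) (toℕ-fromℕ< (m%n<n y n)))

  mod-cong : ∀ {x y} → x ≋ y → x mod n ≡ y mod n
  mod-cong {x} {y} eq =
    toℕ-injective (≡.trans (toℕ-fromℕ< (m%n<n x n)) (≡.trans eq (≡.sym (toℕ-fromℕ< (m%n<n y n)))))

  ≋⇒≡ : {i j : Fin n} → toℕ i ≋ toℕ j → i ≡ j
  ≋⇒≡ {i} {j} eq = toℕ-injective (≡.trans (≡.sym (m<n⇒m%n≡m (toℕ<n i))) (≡.trans eq (m<n⇒m%n≡m (toℕ<n j))))

  mid : Fin n
  mid = k mod n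

  opposite-mid : opposite mid ≡ mid
  opposite-mid = opposite-unique mid (≡.trans (≡.cong (λ x → x + suc x) toℕ-mid) (ℕ.+-suc k k))
    where
    toℕ-mid : toℕ mid ≡ k
    toℕ-mid = ≡.trans (toℕ-fromℕ< (m%n<n k n)) (m<n⇒m%n≡m (s≤s (ℕ.m≤m+n k k)))

  -- On the antidiagonal i + j = 2k; the shift by k + 1 turns this into n + k, that is, into `mid`.
  L : Fin n → Fin n → Fin n
  L i j = (toℕ i + toℕ j + suc k) mod n

  L-comm : ∀ i j → L i j ≡ L j i
  L-comm i j = ≡.cong (λ x → (x + suc k) mod n) (ℕ.+-comm (toℕ i) (toℕ j))

  L-injectiveˡ : ∀ {i i′ j} → L i j ≡ L i′ j → i ≡ i′
  L-injectiveˡ {i} {i′} {j} eq =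
    ≋⇒≡ (≋-cancelʳ (toℕ j) {toℕ i} {toℕ i′}
      (≋-cancelʳ (suc k) {toℕ i + toℕ j} {toℕ i′ + toℕ j}
        (mod-injective (toℕ i + toℕ j + suc k) (toℕ i′ + toℕ j + suc k) eq)))

  L-injectiveʳ : ∀ {i j j′} → L i j ≡ L i j′ → j ≡ j′
  L-injectiveʳ {i} {j} {j′} eq = L-injectiveˡ {j} {j′} {i} (≡.trans (L-comm j i) (≡.trans eq (L-comm i j′)))

  L-diagonal-injective : ∀ {i i′} → L i i ≡ L i′ i′ → i ≡ i′
  L-diagonal-injective {i} {i′} eq =
    ≋⇒≡ (≋-halve {toℕ i} {toℕ i′}
      (≋-cancelʳ (suc k) {toℕ i + toℕ i} {toℕ i′ + toℕ i′}
        (mod-injective (toℕ i + toℕ i + suc k) (toℕ i′ + toℕ i′ + suc k) eq)))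

  L-antidiagonal : ∀ i → L i (opposite i) ≡ mid
  L-antidiagonal i = mod-cong {toℕ i + toℕ (opposite i) + suc k} {k} (begin
    (toℕ i + toℕ (opposite i) + suc k) % n   ≡⟨ ≡.cong (_% n) (regroup (toℕ i) (toℕ (opposite i)) k) ⟩
    (k + (toℕ (opposite i) + suc (toℕ i))) % n   ≡⟨ ≡.cong (λ m → (k + m) % n) (opposite-sum i) ⟩
    (k + n) % n                              ≡⟨ [m+n]%n≡m%n k n ⟩
    k % n                                    ∎)
    where
    open ≡.≡-Reasoning
    regroup : ∀ i oi k → i + oi + suc k ≡ k + (oi + suc i)
    regroup = solve 3 (λ i oi k → i :+ oi :+ (con 1 :+ k) := k :+ (oi :+ (con 1 :+ i))) ≡.refl
      where open +-*-Solver

  -- Adding the two equations eliminates j and leaves 2i plus a constant. As 2 is invertible modulo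
  -- n, i is determined, and then j by the row.
  orthogonal : ∀ {i i′ j j′} → L i j ≡ L i′ j′ → L i (opposite j) ≡ L i′ (opposite j′) → i ≡ i′ × j ≡ j′
  orthogonal {i} {i′} {j} {j′} L≡ oL≡ =
    i≡i′ , L-injectiveʳ {i} {j} {j′} (≡.trans L≡ (≡.cong (λ x → L x j′) (≡.sym i≡i′)))
    where
    regroup : ∀ i j oj k → (i + j + suc k) + (i + oj + suc k) ≡ i + i + ((oj + suc j) + suc (k + k))
    regroup =
      solve 4 (λ i j oj k → (i :+ j :+ (con 1 :+ k)) :+ (i :+ oj :+ (con 1 :+ k)) := i :+ i :+
        ((oj :+ (con 1 :+ j)) :+ (con 1 :+ (k :+ k)))) ≡.refl
      where open +-*-Solver
    collect : ∀ i j → (toℕ i + toℕ j + suc k) + (toℕ i + toℕ (opposite j) + suc k) ≡ toℕ i + toℕ i + (n + n)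
    collect i j =
      ≡.trans (regroup (toℕ i) (toℕ j) (toℕ (opposite j)) k)
        (≡.cong (λ m → toℕ i + toℕ i + (m + n)) (opposite-sum j))
    i≡i′ : i ≡ i′
    i≡i′ = ≋⇒≡ (≋-halve {toℕ i} {toℕ i′} (≋-cancelʳ (n + n) {toℕ i + toℕ i} {toℕ i′ + toℕ i′}
      (≡.subst₂ _≋_ (collect i j) (collect i′ j′)
        (≋-+ {toℕ i + toℕ j + suc k} {toℕ i′ + toℕ j′ + suc k}
          (mod-injective (toℕ i + toℕ j + suc k) (toℕ i′ + toℕ j′ + suc k) L≡)
          (mod-injective (toℕ i + toℕ (opposite j) + suc k) (toℕ i′ + toℕ (opposite j′) + suc k) oL≡)))))

  mirrorOrthogonal : MirrorOrthogonal n
  mirrorOrthogonal = record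
    { L = L ; mid = mid ; opposite-mid = opposite-mid
    ; row-injective = λ {i} {j} {j′} → L-injectiveʳ {i} {j} {j′}
    ; column-injective = λ {i} {i′} {j} → L-injectiveˡ {i} {i′} {j}
    ; diagonal-injective = λ {i} {i′} → L-diagonal-injective {i} {i′}
    ; antidiagonal = L-antidiagonal ; orthogonal = λ {i} {i′} {j} {j′} → orthogonal {i} {i′} {j} {j′} }

module _ (Γ : AbelianGroup c ℓ) where
  open AbelianGroup Γ
  open AbelianGroupSolver Γ using (group-solve; by-hypothesis; _⊕_; _⊖_; _⊜_; 0′)
  open Sum commutativeMonoid using (sum; sum-cong-≋; ∑-distrib-+)
  open SumProperties commutativeMonoid using (sum-injective; sum-zero)
  open Multiples Γ

  NoInvolution : Set (c ⊔ ℓ)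
  NoInvolution = ∀ {x} → x ∙ x ≈ ε → x ≈ ε

  odd-multiple : ∀ k {x} → x ∙ x ≈ ε → suc (k + k) · x ≈ x
  odd-multiple k {x} 2x≈ε = trans (∙-congˡ (trans (×-homo-+ x k k)
    (trans (sym (×-distrib-+ x x k)) (trans (×-congʳ k 2x≈ε) (·-zeroʳ k))))) (identityʳ x)

  odd⇒noInvolution : ∀ k {N} → N ≡ suc (k + k) → HasOrder Γ N → NoInvolution
  odd⇒noInvolution k ≡.refl I 2x≈ε = trans (sym (odd-multiple k 2x≈ε)) (FiniteGroup.order-annihilates Γ I _)

  -- Adding the sum to its own reversal shows that its double is 0.
  symmetric⇒zero-sum : NoInvolution → ∀ {n} {t : Fin n → Carrier} → (∀ i → t i ∙ t (opposite i) ≈ ε) →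
    sum t ≈ ε
  symmetric⇒zero-sum no-involution {t = t} t-sym =
    no-involution (trans (∙-congˡ (sym (sum-injective t opposite-injective)))
      (trans (sym (∑-distrib-+ t (t ∘ opposite))) (sum-zero t-sym)))

  mirrorArray : NoInvolution → ∀ {n} → MirrorOrthogonal n → Tiling (trivial Γ) n n → ZeroSumArray Γ n
  mirrorArray no-involution {n} latin tiles =
    latinArray Γ T H L (λ i j → L i (opposite j)) TH-unique orthogonal
    row-injective column-injective (opposite-injective ∘ row-injective) column-injective
    ΣT ΣH
    (trans (sum-injective T diagonal-injective) ΣT)
    (sum-zero λ i → trans (reflexive (≡.cong H (antidiagonal i))) (inverseʳ _))
    (sum-zero λ i → trans (reflexive (≡.cong T (antidiagonal i))) (inverseʳ _))
    (trans (sum-cong-≋ (λ i → reflexive (≡.cong (H ∘ L i) (opposite-involutive i))))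
           (trans (sum-injective H diagonal-injective) ΣH))
    where
    open MirrorOrthogonal latin
    module t = Tiling tiles
    T H : Fin n → Carrier
    -- As `mid` is fixed by reversal, twice the tile's element there is its symmetry constant.
    -- Subtracting that element centres the tile at 0 and makes it vanish at `mid`.
    T i = t.T i - t.T mid
    H j = t.H j - t.H mid
    TH-unique : ∀ {i i′ j j′} → T i ∙ H j ≈ T i′ ∙ H j′ → i ≡ i′ × j ≡ j′
    TH-unique {i} {i′} {j} {j′} eq = t.unique (by-hypothesis eq
      (group-solve 6 (λ t h t′ h′ m o → (t ⊕ h) ⊕ ((t′ ⊖ m) ⊕ (h′ ⊖ o)) ⊜ (t′ ⊕ h′) ⊕ ((t ⊖ m) ⊕ (h ⊖ o)))
        (t.T i) (t.H j) (t.T i′) (t.H j′) (t.T mid) (t.H mid)))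
    centred : {t : Fin n → Carrier} {τ : Carrier} → (∀ i → t i ∙ t (opposite i) ≈ τ) →
      ∀ i → (t i - t mid) ∙ (t (opposite i) - t mid) ≈ ε
    centred {t} {τ} t-sym i = by-hypothesis
      (trans (t-sym i) (trans (sym (t-sym mid)) (∙-congˡ (reflexive (≡.cong t opposite-mid)))))
      (group-solve 3 (λ x y m → ((x ⊖ m) ⊕ (y ⊖ m)) ⊕ (m ⊕ m) ⊜ 0′ ⊕ (x ⊕ y)) (t i) (t (opposite i)) (t mid))
    ΣT = symmetric⇒zero-sum no-involution (centred t.T-symmetric)
    ΣH = symmetric⇒zero-sum no-involution (centred t.H-symmetric)

  oddArray : ∀ k {n} → n ≡ suc (k + k) → HasOrder Γ (n * n) → ZeroSumArray Γ n
  oddArray k ≡.refl I =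
    mirrorArray (odd⇒noInvolution (k + k * suc (k + k)) (square k) I) (CyclicSquare.mirrorOrthogonal k)
      (tiling _ _ I)
    where
    square : ∀ k → suc (k + k) * suc (k + k) ≡ suc ((k + k * suc (k + k)) + (k + k * suc (k + k)))
    square =
      solve 1 (λ k → (con 1 :+ (k :+ k)) :* (con 1 :+ (k :+ k)) :=
        (con 1 :+ ((k :+ k :* (con 1 :+ (k :+ k))) :+ (k :+ k :* (con 1 :+ (k :+ k)))))) ≡.refl
      where open +-*-Solver

-- Squares made of 2 × 2 blocks

module _ (Γ : AbelianGroup c ℓ) where
  open AbelianGroup Γ
  open Sum commutativeMonoid using (sum; sum-cong-≋)
  open SumProperties commutativeMonoid using (sum-combine)
  open SetoidReasoning setoid

  sum-blocks : ∀ {m} {f : Fin (m * 2) → Carrier} {g : Fin m → Carrier} →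
    (∀ i → f (combine i 0F) ∙ f (combine i 1F) ≈ g i) → sum g ≈ ε → sum f ≈ ε
  sum-blocks {m} {f} {g} pairs Σg≈ε = begin
    sum f                                         ≈⟨ sum-combine m f ⟩
    sum (λ i → sum (λ j → f (combine {m} i j)))   ≈⟨ sum-cong-≋
      (λ i → trans (∙-congˡ (identityʳ _)) (pairs i)) ⟩
    sum g                                         ≈⟨ Σg≈ε ⟩
    ε                                             ∎

  blockArray : ∀ {m} (B : Fin m → Fin m → Fin 2 → Fin 2 → Carrier) →
    (∀ {i i′ j j′ s s′ t t′} → B i j s t ≈ B i′ j′ s′ t′ → (i ≡ i′ × s ≡ s′) × (j ≡ j′ × t ≡ t′)) →
    (∀ i s → sum (λ j → B i j s 0F ∙ B i j s 1F) ≈ ε) →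
    (∀ j t → sum (λ i → B i j 0F t ∙ B i j 1F t) ≈ ε) →
    sum (λ i → B i i 0F 0F ∙ B i i 1F 1F) ≈ ε →
    sum (λ i → B i (opposite i) 0F 1F ∙ B i (opposite i) 1F 0F) ≈ ε →
    ZeroSumArray Γ (m * 2)
  blockArray {m} B distinct rows columns diagonal antidiagonal = record
    { entry = λ k l → entry (remQuot 2 k) (remQuot 2 l)
    ; distinct = λ {k} {k′} {l} {l′} eq →
      let (k≡ , l≡) = distinct eq in remQuot-injective k k′ k≡ , remQuot-injective l l′ l≡
    ; row-sum = λ k → let (i , s) = remQuot {m} 2 k in
        sum-blocks (λ j → ∙-cong (column-entry (i , s) j 0F) (column-entry (i , s) j 1F)) (rows i s)
    ; column-sum = λ l → let (j , t) = remQuot {m} 2 l in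
        sum-blocks (λ i → ∙-cong (row-entry i 0F (j , t)) (row-entry i 1F (j , t))) (columns j t)
    ; diagonal = sum-blocks (λ i → ∙-cong (both-entry i 0F i 0F) (both-entry i 1F i 1F)) diagonal
    ; antidiagonal = sum-blocks (λ i → ∙-cong (opposite-entry i 0F) (opposite-entry i 1F)) antidiagonal
    }
    where
    entry : Fin m × Fin 2 → Fin m × Fin 2 → Carrier
    entry (i , s) (j , t) = B i j s t

    remQuot-injective : ∀ (k k′ : Fin (m * 2)) →
      let (i , s) = remQuot {m} 2 k ; (i′ , s′) = remQuot {m} 2 k′ in i ≡ i′ × s ≡ s′ → k ≡ k′
    remQuot-injective k k′ (i≡ , s≡) =
      ≡.trans (≡.sym (combine-remQuot {m} 2 k)) (≡.trans (≡.cong₂ combine i≡ s≡) (combine-remQuot {m} 2 k′))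

    column-entry : ∀ is j t → entry is (remQuot {m} 2 (combine j t)) ≈ entry is (j , t)
    column-entry is j t = reflexive (≡.cong (entry is) (remQuot-combine j t))

    row-entry : ∀ i s jt → entry (remQuot {m} 2 (combine i s)) jt ≈ entry (i , s) jt
    row-entry i s jt = reflexive (≡.cong (λ is → entry is jt) (remQuot-combine i s))

    both-entry : ∀ i s j t → entry (remQuot {m} 2 (combine i s)) (remQuot {m} 2 (combine j t)) ≈ B i j s t
    both-entry i s j t = trans (row-entry i s _) (column-entry (i , s) j t)

    opposite-entry : ∀ i s →
      entry (remQuot {m} 2 (combine i s)) (remQuot {m} 2 (opposite (combine i s))) ≈ B i (opposite i) s
        (opposite s)
    opposite-entry i s =
      trans (reflexive
        (≡.cong (λ l → entry (remQuot {m} 2 (combine i s)) (remQuot {m} 2 l)) (opposite-combine i s)))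
      (both-entry i s (opposite i) (opposite s))

-- Orderings of the three involutions a, b, a + b of a Klein four-group, read as
-- the difference along a row, along a column and along a diagonal of a 2 × 2 block.
data Direction : Set where
  𝐚 𝐛 𝐜 : Direction

data Ordering : Set where
  abc acb bac bca cab cba : Ordering

horizontal vertical diagonal : Ordering → Direction
horizontal abc = 𝐚
horizontal acb = 𝐚
horizontal bac = 𝐛
horizontal bca = 𝐛
horizontal cab = 𝐜
horizontal cba = 𝐜
vertical abc = 𝐛
vertical acb = 𝐜
vertical bac = 𝐚
vertical bca = 𝐜
vertical cab = 𝐚
vertical cba = 𝐛
diagonal abc = 𝐜
diagonal acb = 𝐛
diagonal bac = 𝐜
diagonal bca = 𝐚
diagonal cab = 𝐛
diagonal cba = 𝐚

-- The Klein four-group and its quotient.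

record InvolutionAdjunction {Γ : AbelianGroup c ℓ} (C : Congruence Γ) (x : AbelianGroup.Carrier Γ)
  (N : ℕ) : Set (c ⊔ lsuc ℓ) where
  open AbelianGroup Γ using (Carrier; _∙_; ε)
  open Congruence C using (_~_)
  field
    C⁺          : Congruence Γ
  open Congruence C⁺ using () renaming (_~_ to _~⁺_; quotient to quotient⁺)
  field
    ~⇒~⁺        : ∀ {y z} → y ~ z → y ~⁺ z
    x~⁺ε        : x ~⁺ ε
    expand      : ∀ {y z} → y ~⁺ z → y ~ z ⊎ y ~ z ∙ x
    q           : ℕ
    coset-count : Finite (AbelianGroup.setoid quotient⁺) q
    q*2≡N       : q * 2 ≡ N

module _ {Γ : AbelianGroup c ℓ} where
  open AbelianGroup Γ

  abstract
    adjoin-involution : ∀ {C : Congruence Γ} {x N} →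
      Finite (AbelianGroup.setoid (Congruence.quotient C)) N →
      ¬ Congruence._~_ C x ε → Congruence._~_ C (x ∙ x) ε → InvolutionAdjunction C x N
    adjoin-involution {C} {x} {N} I x≁ε xx~ε = record
      { C⁺ = A.C⁺
      ; ~⇒~⁺ = λ y~z → A.~⁺-reduce 0 0 (∙-cong-~ y~z ~-refl)
      ; x~⁺ε = A.~⁺-reduce 0 1 (≈⇒~ (group-solve 1 (λ x → x ⊕ 0′ ⊜ 0′ ⊕ (x ⊕ 0′)) x))
      ; expand = λ y~⁺z → cases (A.bounded y~⁺z)
      ; coset-count = A.coset-count
      ; q*2≡N = A.q*p≡N
      }
      where
      open Congruence C using (_~_; quotient; ≈⇒~; ~-refl; ~-trans) renaming (∙-cong to ∙-cong-~)
      open AbelianGroupSolver Γ using (group-solve; _⊕_; _⊜_; 0′)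
      A : PrimeAdjunction C N
      A = adjoin-primeOrder C I {2} {x} (prime[2] , x≁ε , ~-trans (≈⇒~ (∙-congˡ (identityʳ x))) xx~ε)
      module A = PrimeAdjunction A
      cases : ∀ {y z} → ∃[ d ] y ~ z ∙ Multiples._·_ Γ (toℕ {2} d) x → y ~ z ⊎ y ~ z ∙ x
      cases (0F , eq) = inj₁ (~-trans eq (≈⇒~ (identityʳ _)))
      cases (1F , eq) = inj₂ (~-trans eq (≈⇒~ (∙-congˡ (identityʳ x))))

record KleinSubgroup (Γ : AbelianGroup c ℓ) : Set (c ⊔ ℓ) where
  open AbelianGroup Γ
  field
    a b          : Carrier
    a-involution : IsInvolution Γ a
    b-involution : IsInvolution Γ b
    a≉b          : ¬ a ≈ b

  ν : Direction → Carrier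
  ν 𝐚 = a
  ν 𝐛 = b
  ν 𝐜 = a ∙ b

module _ {Γ : AbelianGroup c ℓ} (V : KleinSubgroup Γ) where
  open AbelianGroup Γ
  open AbelianGroupSolver Γ using (group-solve; by-hypothesis; _⊕_; _⊜_; 0′)
  open KleinSubgroup V

  ν-involution : ∀ d → IsInvolution Γ (ν d)
  ν-involution 𝐚 = a-involution
  ν-involution 𝐛 = b-involution
  ν-involution 𝐜 =
    (λ ab≈ε → a≉b (by-hypothesis (trans ab≈ε (sym (proj₂ b-involution)))
      (group-solve 2 (λ a b → a ⊕ (b ⊕ b) ⊜ b ⊕ (a ⊕ b)) a b)))
    , trans (group-solve 2 (λ a b → (a ⊕ b) ⊕ (a ⊕ b) ⊜ (a ⊕ a) ⊕ (b ⊕ b)) a b)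
        (trans (∙-cong (proj₂ a-involution) (proj₂ b-involution)) (identityˡ ε))

  ν-double : ∀ d → ν d ∙ ν d ≈ ε
  ν-double d = proj₂ (ν-involution d)

  ν-ordering : ∀ p → ν (horizontal p) ∙ ν (vertical p) ≈ ν (diagonal p)
  ν-ordering abc = refl
  ν-ordering acb = by-hypothesis (ν-double 𝐚) (group-solve 2 (λ a b → (a ⊕ (a ⊕ b)) ⊕ 0′ ⊜ b ⊕ (a ⊕ a)) a b)
  ν-ordering bac = comm b a
  ν-ordering bca = by-hypothesis (ν-double 𝐛) (group-solve 2 (λ a b → (b ⊕ (a ⊕ b)) ⊕ 0′ ⊜ a ⊕ (b ⊕ b)) a b)
  ν-ordering cab = by-hypothesis (ν-double 𝐚) (group-solve 2 (λ a b → ((a ⊕ b) ⊕ a) ⊕ 0′ ⊜ b ⊕ (a ⊕ a)) a b)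
  ν-ordering cba = by-hypothesis (ν-double 𝐛) (group-solve 2 (λ a b → ((a ⊕ b) ⊕ b) ⊕ 0′ ⊜ a ⊕ (b ⊕ b)) a b)

  ν-triple : ∀ p → ν (horizontal p) ∙ (ν (vertical p) ∙ ν (diagonal p)) ≈ ε
  ν-triple p = trans (sym (assoc _ _ _)) (trans (∙-congʳ (ν-ordering p)) (ν-double (diagonal p)))

  record KleinQuotient (N : ℕ) : Set (c ⊔ lsuc ℓ) where
    field
      C           : Congruence Γ
    open Congruence C using (_~_; quotient)
    field
      ≈⇒~ν        : ∀ {x} d → x ∙ ν d ~ x
      expand      : ∀ {x y} → x ~ y → x ≈ y ⊎ ∃[ d ] x ≈ y ∙ ν d
      q           : ℕ
      coset-count : Finite (AbelianGroup.setoid quotient) q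
      q*4≡N       : q * 4 ≡ N

  abstract
    -- Two adjunctions of an involution, first a, then b; b lies outside {0, a}, so it is still an
    -- involution modulo a.
    kleinQuotient : ∀ {N} → HasOrder Γ N → KleinQuotient N
    kleinQuotient {N} I = record
      { C = B.C⁺
      ; ≈⇒~ν = absorb
      ; expand = λ x~y → cases (⊎.map A.expand A.expand (B.expand x~y))
      ; coset-count = B.coset-count
      ; q*4≡N = ≡.trans (≡.sym (ℕ.*-assoc B.q 2 2)) (≡.trans (≡.cong (_* 2) B.q*2≡N) A.q*2≡N)
      }
      where
      A : InvolutionAdjunction (trivial Γ) a N
      A = adjoin-involution I (proj₁ a-involution) (proj₂ a-involution)
      module A = InvolutionAdjunction A
      b≁ε : ¬ Congruence._~_ A.C⁺ b ε
      b≁ε b~ε = [ proj₁ b-involution , (λ b≈εa → a≉b (sym (trans b≈εa (identityˡ a)))) ]′ (A.expand b~ε)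
      B : InvolutionAdjunction A.C⁺ b A.q
      B = adjoin-involution A.coset-count b≁ε (A.~⇒~⁺ (proj₂ b-involution))
      module B = InvolutionAdjunction B
      open Congruence B.C⁺ using (_~_; ≈⇒~; ~-refl; ~-trans) renaming (∙-cong to ∙-cong-~)
      ν~ε : ∀ d → ν d ~ ε
      ν~ε 𝐚 = B.~⇒~⁺ A.x~⁺ε
      ν~ε 𝐛 = B.x~⁺ε
      ν~ε 𝐜 = ~-trans (∙-cong-~ (ν~ε 𝐚) (ν~ε 𝐛)) (≈⇒~ (identityˡ ε))
      absorb : ∀ {x} d → x ∙ ν d ~ x
      absorb d = ~-trans (∙-cong-~ ~-refl (ν~ε d)) (≈⇒~ (identityʳ _))
      cases : ∀ {x y} → (x ≈ y ⊎ x ≈ y ∙ a) ⊎ (x ≈ y ∙ b ⊎ x ≈ y ∙ b ∙ a) → x ≈ y ⊎ ∃[ d ] x ≈ y ∙ ν d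
      cases (inj₁ (inj₁ eq)) = inj₁ eq
      cases (inj₁ (inj₂ eq)) = inj₂ (𝐚 , eq)
      cases (inj₂ (inj₁ eq)) = inj₂ (𝐛 , eq)
      cases {y = y} (inj₂ (inj₂ eq)) = inj₂ (𝐜 , trans eq (group-solve 3 (λ y a b → (y ⊕ b) ⊕ a ⊜ y ⊕ (a ⊕ b)) y a b))

  δ : Fin 2 → Carrier → Carrier
  δ 0F x = ε
  δ 1F x = x

  δ-double : ∀ s d → δ s (ν d) ∙ δ s (ν d) ≈ ε
  δ-double 0F d = identityˡ ε
  δ-double 1F d = ν-double d

  δ-unique : ∀ {s s′ t t′} p →
    δ s (ν (vertical p)) ∙ δ t (ν (horizontal p)) ≈ δ s′ (ν (vertical p)) ∙ δ t′ (ν (horizontal p)) →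
      s ≡ s′ × t ≡ t′
  δ-unique {s} {s′} {t} {t′} p = go s t s′ t′
    where
    x y : Carrier
    x = ν (vertical p)
    y = ν (horizontal p)
    x≉ε : ¬ x ≈ ε
    x≉ε = proj₁ (ν-involution (vertical p))
    y≉ε : ¬ y ≈ ε
    y≉ε = proj₁ (ν-involution (horizontal p))
    xy≉ε : ¬ x ∙ y ≈ ε
    xy≉ε xy≈ε = proj₁ (ν-involution (diagonal p)) (trans (sym (ν-ordering p)) (trans (comm y x) xy≈ε))
    10≉00 : ¬ x ∙ ε ≈ ε ∙ ε
    10≉00 eq = x≉ε (by-hypothesis eq (group-solve 1 (λ x → x ⊕ (0′ ⊕ 0′) ⊜ 0′ ⊕ (x ⊕ 0′)) x))
    01≉00 : ¬ ε ∙ y ≈ ε ∙ ε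
    01≉00 eq = y≉ε (by-hypothesis eq (group-solve 1 (λ y → y ⊕ (0′ ⊕ 0′) ⊜ 0′ ⊕ (0′ ⊕ y)) y))
    11≉00 : ¬ x ∙ y ≈ ε ∙ ε
    11≉00 eq = xy≉ε (trans eq (identityˡ ε))
    11≉10 : ¬ x ∙ y ≈ x ∙ ε
    11≉10 eq = y≉ε (by-hypothesis eq (group-solve 2 (λ x y → y ⊕ (x ⊕ 0′) ⊜ 0′ ⊕ (x ⊕ y)) x y))
    11≉01 : ¬ x ∙ y ≈ ε ∙ y
    11≉01 eq = x≉ε (by-hypothesis eq (group-solve 2 (λ x y → x ⊕ (0′ ⊕ y) ⊜ 0′ ⊕ (x ⊕ y)) x y))
    10≉01 : ¬ x ∙ ε ≈ ε ∙ y
    10≉01 eq =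
      xy≉ε (trans (by-hypothesis eq (group-solve 2 (λ x y → (x ⊕ y) ⊕ (0′ ⊕ y) ⊜ (y ⊕ y) ⊕ (x ⊕ 0′)) x y))
        (ν-double (horizontal p)))
    go : ∀ s t s′ t′ → δ s x ∙ δ t y ≈ δ s′ x ∙ δ t′ y → s ≡ s′ × t ≡ t′
    go 0F 0F 0F 0F _ = ≡.refl , ≡.refl
    go 0F 1F 0F 1F _ = ≡.refl , ≡.refl
    go 1F 0F 1F 0F _ = ≡.refl , ≡.refl
    go 1F 1F 1F 1F _ = ≡.refl , ≡.refl
    go 0F 0F 0F 1F eq = contradiction (sym eq) 01≉00
    go 0F 0F 1F 0F eq = contradiction (sym eq) 10≉00
    go 0F 0F 1F 1F eq = contradiction (sym eq) 11≉00
    go 0F 1F 0F 0F eq = contradiction eq 01≉00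
    go 0F 1F 1F 0F eq = contradiction (sym eq) 10≉01
    go 0F 1F 1F 1F eq = contradiction (sym eq) 11≉01
    go 1F 0F 0F 0F eq = contradiction eq 10≉00
    go 1F 0F 0F 1F eq = contradiction eq 10≉01
    go 1F 0F 1F 1F eq = contradiction (sym eq) 11≉10
    go 1F 1F 0F 0F eq = contradiction eq 11≉00
    go 1F 1F 0F 1F eq = contradiction eq 11≉01
    go 1F 1F 1F 0F eq = contradiction eq 11≉10

-- Patterns of orderings that make the line sums vanish.

parity : ℕ → Bool
parity zero    = false
parity (suc n) = not (parity n)

module _ (Γ : AbelianGroup c ℓ) where
  open AbelianGroup Γ
  open Sum commutativeMonoid using (sum; sum-cong-≗)

  sum-alternating : ∀ k (g : Bool → Carrier) → g false ∙ g true ≈ ε →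
    sum {k * 2} (λ i → g (parity (toℕ i))) ≈ ε
  sum-alternating zero    g g≈ε = refl
  sum-alternating (suc k) g g≈ε = begin
    g false ∙ (g true ∙ sum {k * 2} (λ i → g (not (not (parity (toℕ i))))))
      ≈⟨ assoc _ _ _ ⟨
    g false ∙ g true ∙ sum {k * 2} (λ i → g (not (not (parity (toℕ i)))))
      ≈⟨ ∙-cong g≈ε (reflexive (sum-cong-≗ {k * 2} λ i → ≡.cong g (not-involutive (parity (toℕ i))))) ⟩
    ε ∙ sum {k * 2} (λ i → g (parity (toℕ i)))
      ≈⟨ identityˡ _ ⟩
    sum {k * 2} (λ i → g (parity (toℕ i)))
      ≈⟨ sum-alternating k g g≈ε ⟩
    ε ∎
    where open SetoidReasoning setoid

module _ {Γ : AbelianGroup c ℓ} (V : KleinSubgroup Γ) where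
  open AbelianGroup Γ
  open AbelianGroupSolver Γ using (group-solve; by-hypothesis; _⊕_; _⊜_; 0′)
  open Sum commutativeMonoid using (sum; sum-cong-≋; ∑-distrib-+)
  open KleinSubgroup V using (ν)

  -- What remains of the line conditions over Γ/V. A row of blocks sums to 2 Σx plus its horizontal
  -- involutions, and 2 Σx = 0 because Σx lies in V; columns and diagonals behave alike.
  record Pattern (m : ℕ) : Set ℓ where
    field
      P            : Fin m → Fin m → Ordering
      rows         : ∀ i → sum (λ j → ν (horizontal (P i j))) ≈ ε
      columns      : ∀ j → sum (λ i → ν (vertical (P i j))) ≈ ε
      main         : sum (λ i → ν (diagonal (P i i))) ≈ ε
      anti         : sum (λ i → ν (diagonal (P i (opposite i)))) ≈ ε

  liftArray : ∀ {N m} (K : KleinQuotient V N) →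
    ZeroSumArray (Congruence.quotient (KleinQuotient.C K)) m → Pattern m → ZeroSumArray Γ (m * 2)
  liftArray {N} {m} K A pattern′ = blockArray Γ B B-unique B-rows B-columns
    (block-sum {g = λ i → ν (diagonal (P i i))} (λ i → main-block (X i i) (P i i)) A.diagonal main)
    (block-sum (λ i → anti-block (X i (opposite i)) (P i (opposite i))) A.antidiagonal anti)
    where
    open Pattern pattern′
    module A = ZeroSumArray A
    open A using () renaming (entry to X)
    open KleinQuotient K using (C; ≈⇒~ν; expand)
    open Congruence C using (_~_; ≈⇒~; ~-sym; ~-trans)

    -- The coset of x is laid out as x, x + h above x + v, x + v + h. As 2h = 2v = 0, either row
    -- sums to 2x + h, either column to 2x + v, and either diagonal to 2x + h + v.
    block : Carrier → Ordering → Fin 2 → Fin 2 → Carrier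
    block x p s t = x ∙ (δ V s (ν (vertical p)) ∙ δ V t (ν (horizontal p)))

    B : Fin m → Fin m → Fin 2 → Fin 2 → Carrier
    B i j = block (X i j) (P i j)

    absorb-δ : ∀ {x} s d → x ∙ δ V s (ν d) ~ x
    absorb-δ 0F d = ≈⇒~ (identityʳ _)
    absorb-δ 1F d = ≈⇒~ν d

    block~ : ∀ x p s t → block x p s t ~ x
    block~ x p s t =
      ~-trans (≈⇒~ (sym (assoc _ _ _))) (~-trans (absorb-δ t (horizontal p)) (absorb-δ s (vertical p)))

    B-unique : ∀ {i i′ j j′ s s′ t t′} → B i j s t ≈ B i′ j′ s′ t′ → (i ≡ i′ × s ≡ s′) × (j ≡ j′ × t ≡ t′)
    B-unique {i} {i′} {j} {j′} {s} {s′} {t} {t′} eq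
      with A.distinct {i} {i′} {j} {j′}
        (~-trans (~-sym (block~ _ (P i j) s t)) (~-trans (≈⇒~ eq) (block~ _ (P i′ j′) s′ t′)))
    ... | ≡.refl , ≡.refl with δ-unique V {s} {s′} {t} {t′} (P i j)
      (AbelianGroupProperties.∙-cancelˡ Γ _ _ _ eq)
    ... | ≡.refl , ≡.refl = (≡.refl , ≡.refl) , (≡.refl , ≡.refl)

    double-vanishes : ∀ {x} → x ~ ε → x ∙ x ≈ ε
    double-vanishes x~ε with expand x~ε
    ... | inj₁ x≈ε = trans (∙-cong x≈ε x≈ε) (identityˡ ε)
    ... | inj₂ (d , x≈ν) = trans (∙-cong (trans x≈ν (identityˡ _)) (trans x≈ν (identityˡ _))) (ν-double V d)

    block-sum : ∀ {n} {x y g : Fin n → Carrier} → (∀ i → y i ≈ (x i ∙ x i) ∙ g i) → sum x ~ ε → sum g ≈ ε →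
      sum y ≈ ε
    block-sum {x = x} {y} {g} y≈xxg Σx~ε Σg≈ε = trans (sum-cong-≋ y≈xxg)
      (trans (∑-distrib-+ (λ i → x i ∙ x i) g)
      (trans (∙-cong (trans (∑-distrib-+ x x) (double-vanishes Σx~ε)) Σg≈ε) (identityˡ ε)))

    row-pair : ∀ x p s → block x p s 0F ∙ block x p s 1F ≈ (x ∙ x) ∙ ν (horizontal p)
    row-pair x p s = by-hypothesis (δ-double V s (vertical p))
      (group-solve 3 (λ x w v → ((x ⊕ (w ⊕ 0′)) ⊕ (x ⊕ (w ⊕ v))) ⊕ 0′ ⊜ ((x ⊕ x) ⊕ v) ⊕ (w ⊕ w))
        x (δ V s (ν (vertical p))) (ν (horizontal p)))

    column-pair : ∀ x p t → block x p 0F t ∙ block x p 1F t ≈ (x ∙ x) ∙ ν (vertical p)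
    column-pair x p t = by-hypothesis (δ-double V t (horizontal p))
      (group-solve 3 (λ x w v → ((x ⊕ (0′ ⊕ v)) ⊕ (x ⊕ (w ⊕ v))) ⊕ 0′ ⊜ ((x ⊕ x) ⊕ w) ⊕ (v ⊕ v))
        x (ν (vertical p)) (δ V t (ν (horizontal p))))

    main-block : ∀ x p → block x p 0F 0F ∙ block x p 1F 1F ≈ (x ∙ x) ∙ ν (diagonal p)
    main-block x p = by-hypothesis (ν-ordering V p)
      (group-solve 4 (λ x w v u → ((x ⊕ (0′ ⊕ 0′)) ⊕ (x ⊕ (w ⊕ v))) ⊕ u ⊜ ((x ⊕ x) ⊕ u) ⊕ (v ⊕ w))
        x (ν (vertical p)) (ν (horizontal p)) (ν (diagonal p)))

    anti-block : ∀ x p → block x p 0F 1F ∙ block x p 1F 0F ≈ (x ∙ x) ∙ ν (diagonal p)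
    anti-block x p = by-hypothesis (ν-ordering V p)
      (group-solve 4 (λ x w v u → ((x ⊕ (0′ ⊕ v)) ⊕ (x ⊕ (w ⊕ 0′))) ⊕ u ⊜ ((x ⊕ x) ⊕ u) ⊕ (v ⊕ w))
        x (ν (vertical p)) (ν (horizontal p)) (ν (diagonal p)))

    B-rows : ∀ i s → sum (λ j → B i j s 0F ∙ B i j s 1F) ≈ ε
    B-rows i s = block-sum (λ j → row-pair (X i j) (P i j) s) (A.row-sum i) (rows i)

    B-columns : ∀ j t → sum (λ i → B i j 0F t ∙ B i j 1F t) ≈ ε
    B-columns j t = block-sum (λ i → column-pair (X i j) (P i j) t) (A.column-sum j) (columns j)

  -- With evenly many blocks on each line one constant ordering works: its involutions cancel in
  -- pairs.
  even-pattern : ∀ k → Pattern (k * 2)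
  even-pattern k = record
    { P = λ _ _ → abc
    ; rows = λ _ → vanish 𝐚 ; columns = λ _ → vanish 𝐛 ; main = vanish 𝐜 ; anti = vanish 𝐜 }
    where
    vanish : ∀ d → sum {k * 2} (λ _ → ν d) ≈ ε
    vanish d = sum-alternating Γ k (λ _ → ν d) (ν-double V d)

-- Starts at 3, since side 1 admits no pattern: a lone ordering leaves one nonzero involution on
-- each line.
oddSize : ℕ → ℕ
oddSize zero    = 3
oddSize (suc k) = 2 + oddSize k

-- Indices of a square of side m + 2, seen as a border of width one around a square of side m.
data Position (m : ℕ) : Set where
  first last : Position m
  inner      : Fin m → Position m

position⁻ : ∀ {m} → Fin (suc m) → Position m
position⁻ {zero}  zero    = last
position⁻ {suc m} zero    = inner zero
position⁻ {suc m} (suc i) with position⁻ i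
... | first   = first
... | last    = last
... | inner j = inner (suc j)

position : ∀ {m} → Fin (2 + m) → Position m
position zero    = first
position (suc i) = position⁻ i

position⁻-last : ∀ m → position⁻ (fromℕ m) ≡ last
position⁻-last zero    = ≡.refl
position⁻-last (suc m) rewrite position⁻-last m = ≡.refl

position⁻-inner : ∀ {m} (i : Fin m) → position⁻ (inject₁ i) ≡ inner i
position⁻-inner zero    = ≡.refl
position⁻-inner (suc i) rewrite position⁻-inner i = ≡.refl

opposite-fromℕ : ∀ m → opposite (fromℕ m) ≡ zero
opposite-fromℕ m = opposite-involutive zero

opposite-inject₁ : ∀ {m} (i : Fin m) → opposite (inject₁ i) ≡ suc (opposite i)
opposite-inject₁ {m} i = opposite-unique (suc (opposite i))
  (≡.trans (≡.cong (λ k → suc (toℕ (opposite i) + suc k)) (toℕ-inject₁ i)) (≡.cong suc (opposite-sum i)))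

module _ {Γ : AbelianGroup c ℓ} (V : KleinSubgroup Γ) where
  open AbelianGroup Γ
  open AbelianGroupSolver Γ using (group-solve; by-hypothesis; _⊕_; _⊜_; 0′)
  open Sum commutativeMonoid using (sum; sum-cong-≗; sum-init-last)
  open KleinSubgroup V using (ν)

  sum-shell : ∀ {m} (t : Fin (2 + m) → Carrier) →
    sum t ≈ t zero ∙ (sum (λ i → t (suc (inject₁ i))) ∙ t (suc (fromℕ m)))
  sum-shell t = ∙-congˡ (sum-init-last (t ∘ suc))

  sum-positions : ∀ {m} (f : Position m → Carrier) →
    sum (f ∘ position) ≈ f first ∙ (sum (f ∘ inner) ∙ f last)
  sum-positions {m} f = trans (sum-shell (f ∘ position)) (∙-congˡ (∙-cong
    (reflexive (sum-cong-≗ (λ i → ≡.cong f (position⁻-inner i))))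
      (reflexive (≡.cong f (position⁻-last m)))))

  sum-odd : ∀ k d → sum {oddSize k} (λ _ → ν d) ≈ ν d
  sum-odd zero    d = by-hypothesis (ν-double V d) (group-solve 1 (λ x → (x ⊕ (x ⊕ (x ⊕ 0′))) ⊕ 0′ ⊜ x ⊕ (x ⊕ x)) (ν d))
  sum-odd (suc k) d = by-hypothesis (ν-double V d)
    (trans (∙-congʳ (∙-congˡ (∙-congˡ (sum-odd k d)))) (group-solve 1 (λ x → (x ⊕ (x ⊕ x)) ⊕ 0′ ⊜ x ⊕ (x ⊕ x)) (ν d)))

  -- Found by exhaustive search.
  core : Pattern V 3
  core = record
    { P = P
    ; rows = λ { 0F → triple abc ; 1F → triple bca ; 2F → triple bca }
    ; columns = λ { 0F → triple bca ; 1F → triple cba ; 2F → triple abc }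
    ; main = triple cab ; anti = triple bac }
    where
    P : Fin 3 → Fin 3 → Ordering
    P 0F 0F = abc
    P 0F 1F = bca
    P 0F 2F = cab
    P 1F 0F = bca
    P 1F 1F = cba
    P 1F 2F = abc
    P 2F 0F = bac
    P 2F 1F = cab
    P 2F 2F = acb
    -- An ordering serves here only to list the three involutions as they occur along a line; their
    -- sum is 0 in any order.
    triple : ∀ p → ν (horizontal p) ∙ (ν (vertical p) ∙ (ν (diagonal p) ∙ ε)) ≈ ε
    triple p = trans (∙-congˡ (∙-congˡ (identityʳ _))) (ν-triple V p)

  -- The edges add a twice to each inner row and b twice to each inner column. Opposite corners are
  -- equal, so they cancel on the diagonals. On a border line the odd number of equal edge
  -- involutions leaves one, and with the two corners it completes a, b, a + b.
  shell : ∀ {m} → (Fin m → Fin m → Ordering) → Position m → Position m → Ordering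
  shell P first     first     = cab
  shell P first     last      = bca
  shell P last      first     = bca
  shell P last      last      = cab
  shell P (inner i) (inner j) = P i j
  shell P _         _         = abc

  enlarge : ∀ k → Pattern V (oddSize k) → Pattern V (oddSize (suc k))
  enlarge k pattern′ = record
    { P = λ i j → shell P (position i) (position j)
    ; rows = λ i → trans (sum-positions (λ q → ν (horizontal (shell P (position i) q)))) (row (position i))
    ; columns = λ j → trans (sum-positions (λ q → ν (vertical (shell P q (position j)))))
      (column (position j))
    ; main = trans (sum-positions (λ q → ν (diagonal (shell P q q)))) (cancel 𝐛 main)
    ; anti = trans (sum-shell (λ i → f (position i) (position (opposite i)))) (trans
        (∙-cong (reflexive (≡.cong (f first) (position⁻-last m))) (∙-cong
          (reflexive (sum-cong-≗ λ i → ≡.cong₂ f (position⁻-inner i)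
            (≡.trans (≡.cong (position ∘ inject₁) (opposite-inject₁ i)) (position⁻-inner (opposite i)))))
          (reflexive (≡.cong₂ f (position⁻-last m) (≡.cong (position ∘ inject₁) (opposite-fromℕ m))))))
        (cancel 𝐚 anti))
    }
    where
    open Pattern pattern′
    m : ℕ
    m = oddSize k
    f : Position m → Position m → Carrier
    f p q = ν (diagonal (shell P p q))
    cancel : ∀ d {x} → x ≈ ε → ν d ∙ (x ∙ ν d) ≈ ε
    cancel d x≈ε = trans (∙-congˡ (trans (∙-congʳ x≈ε) (identityˡ _))) (ν-double V d)
    triple : ∀ p {x} → x ≈ ν (vertical p) → ν (horizontal p) ∙ (x ∙ ν (diagonal p)) ≈ ε
    triple p x≈v = trans (∙-congˡ (∙-congʳ x≈v)) (ν-triple V p)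
    row : ∀ p →
      ν (horizontal (shell P p first)) ∙
        (sum (λ j → ν (horizontal (shell P p (inner j)))) ∙ ν (horizontal (shell P p last))) ≈ ε
    row first     = triple cab (sum-odd k 𝐚)
    row last      = triple bac (sum-odd k 𝐚)
    row (inner i) = cancel 𝐚 (rows i)
    column : ∀ q →
      ν (vertical (shell P first q)) ∙
        (sum (λ i → ν (vertical (shell P (inner i) q))) ∙ ν (vertical (shell P last q))) ≈ ε
    column first     = triple abc (sum-odd k 𝐛)
    column last      = triple cba (sum-odd k 𝐛)
    column (inner j) = cancel 𝐛 (columns j)

  odd-pattern : ∀ k → Pattern V (oddSize k)
  odd-pattern zero    = core
  odd-pattern (suc k) = enlarge k (odd-pattern k)

-- A pair of orthogonal diagonal Latin squares of order 4.
L₄ M₄ : Fin 4 → Fin 4 → Fin 4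
L₄ i j = lookup (lookup
  ( (0F ∷ 1F ∷ 2F ∷ 3F ∷ [])
  ∷ (2F ∷ 3F ∷ 0F ∷ 1F ∷ [])
  ∷ (3F ∷ 2F ∷ 1F ∷ 0F ∷ [])
  ∷ (1F ∷ 0F ∷ 3F ∷ 2F ∷ []) ∷ []) i) j
M₄ i j = lookup (lookup
  ( (0F ∷ 1F ∷ 2F ∷ 3F ∷ [])
  ∷ (3F ∷ 2F ∷ 1F ∷ 0F ∷ [])
  ∷ (1F ∷ 0F ∷ 3F ∷ 2F ∷ [])
  ∷ (2F ∷ 3F ∷ 0F ∷ 1F ∷ []) ∷ []) i) j

injective? : (f : Fin 4 → Fin 4) → Dec (∀ i j → f i ≡ f j → i ≡ j)
injective? f = all? λ i → all? λ j → (f i ≟ f j) →-dec (i ≟ j)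

latin? : (f : Fin 4 → Fin 4 → Fin 4) → Dec (∀ i j j′ → f i j ≡ f i j′ → j ≡ j′)
latin? f = all? λ i → injective? (f i)

orthogonal₄ : ∀ i i′ j j′ → L₄ i j ≡ L₄ i′ j′ → M₄ i j ≡ M₄ i′ j′ → i ≡ i′ × j ≡ j′
orthogonal₄ = toWitness {a? = all? λ i → all? λ i′ → all? λ j → all? λ j′ →
  (L₄ i j ≟ L₄ i′ j′) →-dec ((M₄ i j ≟ M₄ i′ j′) →-dec ((i ≟ i′) ×-dec (j ≟ j′)))} _

module _ {Γ : AbelianGroup c ℓ} (V : KleinSubgroup Γ) where
  open AbelianGroup Γ
  open AbelianGroupSolver Γ using (group-solve; by-hypothesis; _⊕_; _⊖_; ⊝_; _⊜_; 0′)
  open Sum commutativeMonoid using (sum)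
  open SumProperties commutativeMonoid using (sum-injective)
  open KleinSubgroup V

  -- H is V, and the members of T have doubles 0, b, a, a + b, so doubling `T i ∙ H j` recovers i.
  -- The last member of T is -(g + h) rather than g + h, to make T sum to zero.
  array₄ : ∀ {g h} → g ∙ g ≈ a → h ∙ h ≈ b → ZeroSumArray Γ 4
  array₄ {g} {h} gg≈a hh≈b = latinArray Γ T H L₄ M₄ TH-unique
    (λ {i} {i′} {j} {j′} → orthogonal₄ i i′ j j′)
    (λ {i} {j} {j′} → toWitness {a? = latin? L₄} _ i j j′)
    (λ {i} {i′} {j} → toWitness {a? = latin? (λ j i → L₄ i j)} _ j i i′)
    (λ {i} {j} {j′} → toWitness {a? = latin? M₄} _ i j j′)
    (λ {i} {i′} {j} → toWitness {a? = latin? (λ j i → M₄ i j)} _ j i i′)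
    ΣT ΣH
    (trans (sum-injective T (λ {i} {j} → toWitness {a? = injective? (λ i → L₄ i i)} _ i j)) ΣT)
    (trans (sum-injective H (λ {i} {j} → toWitness {a? = injective? (λ i → M₄ i i)} _ i j)) ΣH)
    (trans (sum-injective T (λ {i} {j} → toWitness {a? = injective? (λ i → L₄ i (opposite i))} _ i j)) ΣT)
    (trans (sum-injective H (λ {i} {j} → toWitness {a? = injective? (λ i → M₄ i (opposite i))} _ i j)) ΣH)
    where
    T H : Fin 4 → Carrier
    T 0F = ε
    T 1F = h
    T 2F = g
    T 3F = (g ∙ h) ⁻¹
    H i = δ V (Fin.quotient 2 i) a ∙ δ V (Fin.remainder {2} 2 i) b

    H-injective : ∀ {i j} → H i ≈ H j → i ≡ j
    -- `bac` has vertical involution a and horizontal involution b, matching the two summands of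
    -- `H`.
    H-injective {i} {j} eq with s≡ , t≡ ← δ-unique V {Fin.quotient 2 i} {Fin.quotient 2 j} {Fin.remainder {2} 2 i} {Fin.remainder {2} 2 j} bac eq
      =
        ≡.trans (≡.sym (combine-remQuot {2} 2 i))
          (≡.trans (≡.cong₂ combine s≡ t≡) (combine-remQuot {2} 2 j))

    TT≈H : ∀ i → T i ∙ T i ≈ H i
    TT≈H 0F = refl
    TT≈H 1F = trans hh≈b (sym (identityˡ b))
    TT≈H 2F = trans gg≈a (sym (identityʳ a))
    TT≈H 3F = by-hypothesis (trans (sym (ν-double V 𝐜)) (∙-congˡ (sym (∙-cong gg≈a hh≈b))))
      (group-solve 4 (λ g h a b → (⊝ (g ⊕ h) ⊖ (g ⊕ h)) ⊕ ((a ⊕ b) ⊕ ((g ⊕ g) ⊕ (h ⊕ h))) ⊜ (a ⊕ b) ⊕ 0′) g h a b)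

    HH≈ε : ∀ j → H j ∙ H j ≈ ε
    HH≈ε j = trans (group-solve 2 (λ x y → (x ⊕ y) ⊕ (x ⊕ y) ⊜ (x ⊕ x) ⊕ (y ⊕ y)) _ _)
      (trans (∙-cong (δ-double V (Fin.quotient 2 j) 𝐚) (δ-double V (Fin.remainder {2} 2 j) 𝐛))
        (identityˡ ε))

    double : ∀ i j → (T i ∙ H j) ∙ (T i ∙ H j) ≈ H i
    double i j = trans (group-solve 2 (λ x y → (x ⊕ y) ⊕ (x ⊕ y) ⊜ (x ⊕ x) ⊕ (y ⊕ y)) _ _)
      (trans (∙-cong (TT≈H i) (HH≈ε j)) (identityʳ _))

    TH-unique : ∀ {i i′ j j′} → T i ∙ H j ≈ T i′ ∙ H j′ → i ≡ i′ × j ≡ j′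
    TH-unique {i} {i′} {j} {j′} eq = i≡i′ , H-injective (AbelianGroupProperties.∙-cancelˡ Γ (T i) _ _
      (trans eq (∙-congʳ (reflexive (≡.cong T (≡.sym i≡i′))))))
      where
      i≡i′ : i ≡ i′
      i≡i′ = H-injective (trans (sym (double i j)) (trans (∙-cong eq eq) (double i′ j′)))

    ΣT : sum T ≈ ε
    ΣT = group-solve 2 (λ g h → 0′ ⊕ (h ⊕ (g ⊕ ((⊝ (g ⊕ h)) ⊕ 0′))) ⊜ 0′) g h
    ΣH : sum H ≈ ε
    ΣH =
      trans (group-solve 2
        (λ a b → (0′ ⊕ 0′) ⊕ ((0′ ⊕ b) ⊕ ((a ⊕ 0′) ⊕ ((a ⊕ b) ⊕ 0′))) ⊜ (a ⊕ b) ⊕ (a ⊕ b)) a b)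
          (ν-double V 𝐜)

-- Splitting off an involution that is not a double.

module _ {Γ : AbelianGroup c ℓ} where
  open AbelianGroup Γ
  open AbelianGroupSolver Γ using (group-solve; by-hypothesis; _⊕_; _⊖_; ⊝_; _⊜_; 0′)

  -- A subgroup of index two avoiding σ, given by the congruence with that kernel.
  record Complement (σ : Carrier) : Set (c ⊔ lsuc ℓ) where
    field
      C    : Congruence Γ
    open Congruence C using (_~_)
    field
      σ≁ε  : ¬ σ ~ ε
      half : ∀ x → x ~ ε ⊎ x ~ σ

  -- The witness is an index rather than an element, to keep the relation in level ℓ.
  modulo-doubles : ∀ {N} → HasOrder Γ N → Congruence Γ
  modulo-doubles {N} I = record
    { _~_ = λ x y → ∃[ i ] x ≈ y ∙ (to i ∙ to i)
    ; isEquivalence = record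
      { refl = mk ε (group-solve 1 (λ x → x ⊜ x ⊕ (0′ ⊕ 0′)) _)
      ; sym = λ {x} {y} (i , x≈y+2i) → mk (to i ⁻¹) (by-hypothesis (sym x≈y+2i)
          (group-solve 3 (λ x y z → y ⊕ x ⊜ (x ⊕ (⊝ z ⊖ z)) ⊕ (y ⊕ (z ⊕ z))) x y (to i)))
      ; trans = λ {x} {y} {z} (i , x≈y+2i) (j , y≈z+2j) → mk (to i ∙ to j)
        (trans x≈y+2i (trans (∙-congʳ y≈z+2j)
          (group-solve 3 (λ z i j → (z ⊕ (j ⊕ j)) ⊕ (i ⊕ i) ⊜ z ⊕ ((i ⊕ j) ⊕ (i ⊕ j))) z (to i) (to j))))
      }
    ; ≈⇒~ = λ x≈y → mk ε (trans x≈y (group-solve 1 (λ x → x ⊜ x ⊕ (0′ ⊕ 0′)) _))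
    ; ∙-cong = λ {w} {x} {y} {z} (i , w≈x+2i) (j , y≈z+2j) → mk (to i ∙ to j) (trans (∙-cong w≈x+2i y≈z+2j)
        (group-solve 4 (λ x z i j → (x ⊕ (i ⊕ i)) ⊕ (z ⊕ (j ⊕ j)) ⊜ (x ⊕ z) ⊕ ((i ⊕ j) ⊕ (i ⊕ j))) x z (to i) (to j)))
    }
    where
    open FiniteProperties setoid I using (to; from; strictlyInverseˡ)
    mk : ∀ {x y} z → x ≈ y ∙ (z ∙ z) → ∃[ i ] x ≈ y ∙ (to i ∙ to i)
    mk z eq = from z , trans eq (∙-congˡ (∙-cong (sym (strictlyInverseˡ z)) (sym (strictlyInverseˡ z))))

  -- Every element is killed by 2 modulo C. While some x is neither 0 nor σ, adjoining it keeps σ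
  -- nonzero, because σ could become 0 only by equalling x. The number of classes halves each time,
  -- until 0 and σ alone are left.
  shrink : ∀ {σ N} → Acc _<_ N → (C : Congruence Γ) →
    Finite (AbelianGroup.setoid (Congruence.quotient C)) N →
    (∀ x → Congruence._~_ C (x ∙ x) ε) → ¬ Congruence._~_ C σ ε → Complement σ
  shrink {σ} {N} (acc rec) C I doubles~ε σ≁ε =
    case search (λ x~y (x≁ε , x≁σ) → (λ y~ε → x≁ε (~-trans x~y y~ε)) , (λ y~σ → x≁σ (~-trans x~y y~σ)))
                (λ x → ¬? (x ≈? ε) ×-dec ¬? (x ≈? σ)) of λ where
      (no none) → record
        { C = C ; σ≁ε = σ≁ε
        ; half = half none }
      (yes (x , x≁ε , x≁σ)) → continue (adjoin-involution I x≁ε (doubles~ε x)) x≁σ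
    where
    open Congruence C using (_~_; quotient; ~-sym; ~-trans; ≈⇒~)
    open FiniteProperties (AbelianGroup.setoid quotient) I
      using (search; from) renaming (_≈?_ to infix 5 _≈?_)
    half : ¬ (∃[ x ] ¬ x ~ ε × ¬ x ~ σ) → ∀ x → x ~ ε ⊎ x ~ σ
    half none x with x ≈? ε | x ≈? σ
    ... | yes x~ε | _       = inj₁ x~ε
    ... | no  _   | yes x~σ = inj₂ x~σ
    ... | no  x≁ε | no  x≁σ = contradiction (x , x≁ε , x≁σ) none

    continue : ∀ {x} → InvolutionAdjunction C x N → ¬ x ~ σ → Complement σ
    continue {x} A x≁σ = shrink (rec q<N) C⁺ coset-count (λ y → ~⇒~⁺ (doubles~ε y))
      (λ σ~⁺ε → [ σ≁ε , (λ σ~εx → x≁σ (~-sym (~-trans σ~εx (≈⇒~ (identityˡ x))))) ]′ (expand σ~⁺ε))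
      where
      open InvolutionAdjunction A
      q<N : q < N
      q<N = ≡.subst (q <_) q*2≡N (ℕ.m<m*n q 2 {{≢-nonZero λ q≡0 →
        case ≡.subst Fin (≡.trans (≡.sym q*2≡N) (≡.cong (_* 2) q≡0)) (from ε) of λ ()}} (s≤s (s≤s z≤n)))

  abstract
    complement : ∀ {σ N} → HasOrder Γ N → (∀ y → ¬ y ∙ y ≈ σ) → Complement σ
    complement {σ} {N} I not-double = shrink (<-wellFounded _) D
      (proj₂ (Finite-coarsen (Congruence.isEquivalence D) _~?_ isEquivalence (Congruence.≈⇒~ D) I))
      (λ x → from x , trans (sym (identityˡ _))
        (∙-congˡ (∙-cong (sym (strictlyInverseˡ x)) (sym (strictlyInverseˡ x)))))
      (λ (i , σ≈2i) → not-double (to i) (sym (trans σ≈2i (identityˡ _))))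
      where
      D : Congruence Γ
      D = modulo-doubles I
      open FiniteProperties setoid I using (to; from; strictlyInverseˡ; _≈?_)
      _~?_ : Decidable (Congruence._~_ D)
      x ~? y = any? λ i → x ≈? (y ∙ (to i ∙ to i))

  -- The projection of Γ = K ⊕ ⟨σ⟩ onto the kernel K of the congruence.
  module Projection {σ : Carrier} (σσ≈ε : σ ∙ σ ≈ ε) (K : Complement σ) where
    open Complement K public
    open Congruence C public using (_~_; ≈⇒~; ~-sym; ~-trans) renaming (∙-cong to ~-∙-cong)

    In⟨σ⟩ : Carrier → Set ℓ
    In⟨σ⟩ z = z ≈ ε ⊎ z ≈ σ

    In⟨σ⟩-∙ : ∀ {x y} → In⟨σ⟩ x → In⟨σ⟩ y → In⟨σ⟩ (x ∙ y)
    In⟨σ⟩-∙ (inj₁ x≈ε) y∈        = ⊎.map (trans xy≈y) (trans xy≈y) y∈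
      where xy≈y = trans (∙-congʳ x≈ε) (identityˡ _)
    In⟨σ⟩-∙ (inj₂ x≈σ) (inj₁ y≈ε) = inj₂ (trans (∙-cong x≈σ y≈ε) (identityʳ σ))
    In⟨σ⟩-∙ (inj₂ x≈σ) (inj₂ y≈σ) = inj₁ (trans (∙-cong x≈σ y≈σ) σσ≈ε)

    In⟨σ⟩-double : ∀ {z} → In⟨σ⟩ z → z ∙ z ≈ ε
    In⟨σ⟩-double (inj₁ z≈ε) = trans (∙-cong z≈ε z≈ε) (identityˡ ε)
    In⟨σ⟩-double (inj₂ z≈σ) = trans (∙-cong z≈σ z≈σ) σσ≈ε

    -- K meets the subgroup of σ only in 0.
    kernel-unique : ∀ {x y z} → x ~ ε → y ~ ε → In⟨σ⟩ z → x ≈ y ∙ z → x ≈ y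
    kernel-unique x~ε y~ε (inj₁ z≈ε) x≈yz = trans x≈yz (trans (∙-congˡ z≈ε) (identityʳ _))
    kernel-unique {x} {y} x~ε y~ε (inj₂ z≈σ) x≈yz = contradiction
      (~-trans (≈⇒~ (sym (identityˡ σ))) (~-trans (~-∙-cong (~-sym y~ε) (≈⇒~ (sym z≈σ)))
        (~-trans (≈⇒~ (sym x≈yz)) x~ε))) σ≁ε

    χ : Carrier → Carrier
    χ x = [ (λ _ → ε) , (λ _ → σ) ]′ (half x)

    χ-In⟨σ⟩ : ∀ x → In⟨σ⟩ (χ x)
    χ-In⟨σ⟩ x with half x
    ... | inj₁ _ = inj₁ refl
    ... | inj₂ _ = inj₂ refl

    π : Carrier → Carrier
    π x = x ∙ χ x

    π~ε : ∀ x → π x ~ ε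
    π~ε x with half x
    ... | inj₁ x~ε = ~-trans (≈⇒~ (identityʳ x)) x~ε
    ... | inj₂ x~σ = ~-trans (~-∙-cong x~σ (≈⇒~ refl)) (≈⇒~ σσ≈ε)

    π-∙ : ∀ x y → π x ∙ π y ≈ π (x ∙ y)
    π-∙ x y = kernel-unique (~-trans (~-∙-cong (π~ε x) (π~ε y)) (≈⇒~ (identityˡ ε))) (π~ε (x ∙ y))
      (In⟨σ⟩-∙ (In⟨σ⟩-∙ (χ-In⟨σ⟩ x) (χ-In⟨σ⟩ y)) (χ-In⟨σ⟩ (x ∙ y)))
      (by-hypothesis (sym (In⟨σ⟩-double (χ-In⟨σ⟩ (x ∙ y))))
        (group-solve 5 (λ x y s t u → ((x ⊕ s) ⊕ (y ⊕ t)) ⊕ (u ⊕ u) ⊜ (((x ⊕ y) ⊕ u) ⊕ ((s ⊕ t) ⊕ u)) ⊕ 0′)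
          x y (χ x) (χ y) (χ (x ∙ y))))

    -- The choice made by `half` is not assumed to respect equality; it is enough that both
    -- projections lie in K and differ by an element of the subgroup of σ.
    π-cong : ∀ {x y} → x ≈ y → π x ≈ π y
    π-cong {x} {y} x≈y = kernel-unique (π~ε x) (π~ε y) (In⟨σ⟩-∙ (χ-In⟨σ⟩ x) (χ-In⟨σ⟩ y))
      (trans (∙-congʳ x≈y) (by-hypothesis (sym (In⟨σ⟩-double (χ-In⟨σ⟩ y)))
        (group-solve 3 (λ y s t → (y ⊕ s) ⊕ (t ⊕ t) ⊜ ((y ⊕ t) ⊕ (s ⊕ t)) ⊕ 0′) y (χ x) (χ y))))

    π-absorb : ∀ x → π x ≈ x ⊎ π x ≈ x ∙ σ
    π-absorb x = ⊎.map (λ χ≈ε → trans (∙-congˡ χ≈ε) (identityʳ x)) ∙-congˡ (χ-In⟨σ⟩ x)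

flip² : Bool → Fin 2 → Fin 2
flip² false s = s
flip² true  s = opposite s

flip²-injective : ∀ β {s t} → flip² β s ≡ flip² β t → s ≡ t
flip²-injective false eq = eq
flip²-injective true  eq = opposite-injective eq

flip²-opposite : ∀ β s → flip² β (opposite s) ≡ opposite (flip² β s)
flip²-opposite false s = ≡.refl
flip²-opposite true  s = ≡.refl

module _ {Γ : AbelianGroup c ℓ} (V : KleinSubgroup Γ) where
  open AbelianGroup Γ
  open AbelianGroupSolver Γ using (group-solve; by-hypothesis; _⊕_; _⊖_; _⊜_; 0′)
  open AbelianGroupProperties Γ using (∙-cancelˡ)
  open Sum commutativeMonoid using (sum; sum-cong-≋)
  open KleinSubgroup V renaming (a to σ; b to ι)

  -- T + H tiles K modulo ι. The rows of the square come in pairs t, σ - η - t and its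
  -- columns in pairs h, η - h, and the 2 × 2 block of such pairs at (i , j) is rotated
  -- by a half turn when i + j is odd.
  checkerboardArray : ∀ {N} (K : Complement σ) → Congruence._~_ (Complement.C K) ι ε →
    (Q : KleinQuotient V N) → ∀ k → Tiling (KleinQuotient.C Q) (k * 2) (k * 2) → ZeroSumArray Γ (k * 2 * 2)
  checkerboardArray K ι~ε Q k tiles = blockArray Γ B B-unique B-rows B-columns
      (all-σ (λ i → trans
        (∙-congˡ (reflexive
          (≡.cong₂ (λ s u → e s u i i) (flip²-opposite (β i i) 0F) (flip²-opposite (β i i) 0F))))
        (complementary (flip² (β i i) 0F) (flip² (β i i) 0F) i i)))
      (all-σ (λ i → let j = opposite i in trans
        (∙-congˡ (reflexive
          (≡.cong₂ (λ s u → e s u i j) (flip²-opposite (β i j) 0F) (flip²-opposite (β i j) 1F))))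
        (complementary (flip² (β i j) 0F) (flip² (β i j) 1F) i j)))
    where
    open Projection {Γ = Γ} (proj₂ a-involution) K
    module T = Tiling tiles
    open KleinQuotient Q using (≈⇒~ν)
    open Congruence (KleinQuotient.C Q) using () renaming (_~_ to _~ᵥ_; ≈⇒~ to ≈⇒~ᵥ; ~-sym to ~ᵥ-sym;
      ~-trans to ~ᵥ-trans; ∙-cong to ~ᵥ-∙-cong)
    m : ℕ
    m = k * 2

    -- `η₀` is the symmetry constant of the projected tile H. The extra ι makes the partner η - h of
    -- h a reflected element of the tile moved by ι, so that the pairs of columns together use H and
    -- H + ι.
    η₀ η : Carrier
    η₀ = π T.η
    η = η₀ ∙ ι

    tt hh : Fin 2 → Fin m → Carrier
    tt 0F i = π (T.T i)
    tt 1F i = (σ - η) - π (T.T i)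
    hh 0F j = π (T.H j)
    hh 1F j = η - π (T.H j)

    -- The pair constants σ - η and η add up to σ, so diagonally opposite entries of a block are x
    -- and σ - x. The entries with first index 0 fill K, and their complements fill the coset of σ.
    e : Fin 2 → Fin 2 → Fin m → Fin m → Carrier
    e s u i j = tt s i ∙ hh u j

    hh-symmetric : ∀ j → hh 1F j ≈ hh 0F (opposite j) ∙ ι
    hh-symmetric j = by-hypothesis (sym (trans (π-∙ (T.H j) (T.H (opposite j))) (π-cong (T.H-symmetric j))))
      (group-solve 4 (λ z i h h′ → ((z ⊕ i) ⊖ h) ⊕ (h ⊕ h′) ⊜ (h′ ⊕ i) ⊕ z) η₀ ι (π (T.H j)) (π (T.H (opposite j))))

    tt-pair : ∀ s i → tt s i ∙ tt (opposite s) i ≈ σ - η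
    tt-pair 0F i = group-solve 2 (λ τ t → t ⊕ (τ ⊖ t) ⊜ τ) (σ - η) (π (T.T i))
    tt-pair 1F i = group-solve 2 (λ τ t → (τ ⊖ t) ⊕ t ⊜ τ) (σ - η) (π (T.T i))

    hh-pair : ∀ u j → hh u j ∙ hh (opposite u) j ≈ η
    hh-pair 0F j = group-solve 2 (λ η h → h ⊕ (η ⊖ h) ⊜ η) η (π (T.H j))
    hh-pair 1F j = group-solve 2 (λ η h → (η ⊖ h) ⊕ h ⊜ η) η (π (T.H j))

    complementary : ∀ s u i j → e s u i j ∙ e (opposite s) (opposite u) i j ≈ σ
    complementary s u i j = trans (group-solve 4 (λ x y z w → (x ⊕ y) ⊕ (z ⊕ w) ⊜ (x ⊕ z) ⊕ (y ⊕ w)) (tt s i) (hh u j) _ _)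
      (trans (∙-cong (tt-pair s i) (hh-pair u j)) (group-solve 2 (λ σ η → (σ ⊖ η) ⊕ η ⊜ σ) σ η))

    σσ≈ε : σ ∙ σ ≈ ε
    σσ≈ε = proj₂ a-involution

    π~ᵥ : ∀ x → π x ~ᵥ x
    π~ᵥ x = [ ≈⇒~ᵥ , (λ eq → ~ᵥ-trans (≈⇒~ᵥ eq) (≈⇒~ν 𝐚)) ]′ (π-absorb x)

    reflected : Fin 2 → Fin m → Fin m
    reflected 0F j = j
    reflected 1F j = opposite j

    hh~ᵥ : ∀ u j → hh u j ~ᵥ T.H (reflected u j)
    hh~ᵥ 0F j = π~ᵥ _
    hh~ᵥ 1F j = ~ᵥ-trans (≈⇒~ᵥ (hh-symmetric j)) (~ᵥ-trans (≈⇒~ν 𝐛) (π~ᵥ _))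

    e₀~ᵥ : ∀ u i j → e 0F u i j ~ᵥ T.T i ∙ T.H (reflected u j)
    e₀~ᵥ u i j = ~ᵥ-∙-cong (π~ᵥ _) (hh~ᵥ u j)

    clash : ∀ {i i′ j j′} → i ≡ i′ → j ≡ opposite j′ → ¬ e 0F 0F i j ≈ e 0F 1F i′ j′
    clash {i} {j′ = j′} ≡.refl ≡.refl eq = proj₁ b-involution
      (by-hypothesis (trans (∙-congˡ (sym (hh-symmetric j′))) (sym eq))
      (group-solve 3 (λ t h i → i ⊕ (t ⊕ h) ⊜ 0′ ⊕ (t ⊕ (h ⊕ i))) (π (T.T i)) (π (T.H (opposite j′))) ι))

    e₀-unique : ∀ u u′ {i i′ j j′} → e 0F u i j ≈ e 0F u′ i′ j′ → (i ≡ i′ × j ≡ j′) × u ≡ u′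
    e₀-unique u u′ {i} {i′} {j} {j′} eq =
      cases u u′ eq (T.unique (~ᵥ-trans (~ᵥ-sym (e₀~ᵥ u i j)) (~ᵥ-trans (≈⇒~ᵥ eq) (e₀~ᵥ u′ i′ j′))))
      where
      cases : ∀ u u′ → e 0F u i j ≈ e 0F u′ i′ j′ → i ≡ i′ × reflected u j ≡ reflected u′ j′ →
        (i ≡ i′ × j ≡ j′) × u ≡ u′
      cases 0F 0F _  (i≡ , j≡) = (i≡ , j≡) , ≡.refl
      cases 1F 1F _  (i≡ , j≡) = (i≡ , opposite-injective j≡) , ≡.refl
      cases 0F 1F eq (i≡ , j≡) = contradiction eq (clash i≡ j≡)
      cases 1F 0F eq (i≡ , j≡) = contradiction (sym eq) (clash (≡.sym i≡) (≡.sym j≡))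

    hh~ε : ∀ u j → hh u j ~ ε
    hh~ε 0F j = π~ε _
    hh~ε 1F j = ~-trans (≈⇒~ (hh-symmetric j)) (~-trans (~-∙-cong (π~ε _) ι~ε) (≈⇒~ (identityˡ ε)))

    e₀~ε : ∀ u i j → e 0F u i j ~ ε
    e₀~ε u i j = ~-trans (~-∙-cong (π~ε _) (hh~ε u j)) (≈⇒~ (identityˡ ε))

    e₁~σ : ∀ u i j → e 1F u i j ~ σ
    e₁~σ u i j =
      ~-trans (≈⇒~ (sym (identityʳ _))) (~-trans (~-∙-cong (≈⇒~ refl) (~-sym (e₀~ε (opposite u) i j)))
      (≈⇒~ (complementary 1F u i j)))

    e-unique : ∀ s s′ u u′ {i i′ j j′} → e s u i j ≈ e s′ u′ i′ j′ → (i ≡ i′ × j ≡ j′) × (s ≡ s′ × u ≡ u′)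
    e-unique 0F 0F u u′ eq = let (ij , u≡) = e₀-unique u u′ eq in ij , ≡.refl , u≡
    e-unique 0F 1F u u′ eq =
      contradiction (~-trans (~-sym (e₁~σ u′ _ _)) (~-trans (≈⇒~ (sym eq)) (e₀~ε u _ _))) σ≁ε
    e-unique 1F 0F u u′ eq =
      contradiction (~-trans (~-sym (e₁~σ u _ _)) (~-trans (≈⇒~ eq) (e₀~ε u′ _ _))) σ≁ε
    e-unique 1F 1F u u′ {i} {i′} {j} {j′} eq =
      let (ij , u≡) = e₀-unique (opposite u) (opposite u′) (∙-cancelˡ (e 1F u i j) _ _
            (trans (complementary 1F u i j) (trans (sym (complementary 1F u′ i′ j′)) (∙-congʳ (sym eq)))))
      in ij , ≡.refl , opposite-injective u≡

    β : Fin m → Fin m → Bool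
    β i j = parity (toℕ i) xor parity (toℕ j)

    B : Fin m → Fin m → Fin 2 → Fin 2 → Carrier
    B i j s u = e (flip² (β i j) s) (flip² (β i j) u) i j

    B-unique : ∀ {i i′ j j′ s s′ u u′} → B i j s u ≈ B i′ j′ s′ u′ → (i ≡ i′ × s ≡ s′) × (j ≡ j′ × u ≡ u′)
    B-unique {i} {i′} {j} {j′} {s} {s′} {u} {u′} eq =
      conclude (e-unique (flip² (β i j) s) (flip² (β i′ j′) s′) (flip² (β i j) u) (flip² (β i′ j′) u′) eq)
      where
      conclude : (i ≡ i′ × j ≡ j′) ×
        (flip² (β i j) s ≡ flip² (β i′ j′) s′ × flip² (β i j) u ≡ flip² (β i′ j′) u′) →
        (i ≡ i′ × s ≡ s′) × (j ≡ j′ × u ≡ u′)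
      conclude ((≡.refl , ≡.refl) , s≡ , u≡) =
        (≡.refl , flip²-injective (β i j) s≡) , (≡.refl , flip²-injective (β i j) u≡)

    sum-checkerboard : ∀ x (g : Bool → Carrier) → g false ∙ g true ≈ ε →
      sum {m} (λ j → g (x xor parity (toℕ j))) ≈ ε
    sum-checkerboard false g g≈ε = sum-alternating Γ k g g≈ε
    sum-checkerboard true  g g≈ε = sum-alternating Γ k (g ∘ not) (trans (comm _ _) g≈ε)

    -- This is the effect of the half turns. Along a line of blocks x and its partner x' alternate,
    -- each doubled and joined by the same constant z from the other coordinate; two neighbours give
    -- 2(x + x' + z) = 2σ = 0.
    square-vanishes : ∀ {x x′ y z} → x ∙ x′ ≈ y → y ∙ z ≈ σ → ((x ∙ x) ∙ z) ∙ ((x′ ∙ x′) ∙ z) ≈ ε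
    square-vanishes {x} {x′} {y} {z} xx′≈y yz≈σ = trans
      (group-solve 3 (λ x x′ z → ((x ⊕ x) ⊕ z) ⊕ ((x′ ⊕ x′) ⊕ z) ⊜ ((x ⊕ x′) ⊕ z) ⊕ ((x ⊕ x′) ⊕ z)) x x′ z)
      (trans (∙-cong xx′z≈σ xx′z≈σ) σσ≈ε)
      where
      xx′z≈σ : (x ∙ x′) ∙ z ≈ σ
      xx′z≈σ = trans (∙-congʳ xx′≈y) yz≈σ

    B-rows : ∀ i s → sum (λ j → B i j s 0F ∙ B i j s 1F) ≈ ε
    B-rows i s = trans (sum-cong-≋ pair) (sum-checkerboard (parity (toℕ i)) g
      (square-vanishes (tt-pair s i) (group-solve 2 (λ σ η → (σ ⊖ η) ⊕ η ⊜ σ) σ η)))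
      where
      g : Bool → Carrier
      g x = (tt (flip² x s) i ∙ tt (flip² x s) i) ∙ η
      pair : ∀ j → B i j s 0F ∙ B i j s 1F ≈ g (β i j)
      pair j = trans (group-solve 3 (λ x y z → (x ⊕ y) ⊕ (x ⊕ z) ⊜ (x ⊕ x) ⊕ (y ⊕ z)) (tt (flip² (β i j) s) i) _ _)
        (∙-congˡ (trans (∙-congˡ (reflexive (≡.cong (λ u → hh u j) (flip²-opposite (β i j) 0F))))
          (hh-pair (flip² (β i j) 0F) j)))

    B-columns : ∀ j u → sum (λ i → B i j 0F u ∙ B i j 1F u) ≈ ε
    B-columns j u = trans (sum-cong-≋ pair) (sum-checkerboard (parity (toℕ j)) g
      (square-vanishes (hh-pair u j) (group-solve 2 (λ σ η → η ⊕ (σ ⊖ η) ⊜ σ) σ η)))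
      where
      g : Bool → Carrier
      g x = (hh (flip² x u) j ∙ hh (flip² x u) j) ∙ (σ - η)
      pair : ∀ i → B i j 0F u ∙ B i j 1F u ≈ g (parity (toℕ j) xor parity (toℕ i))
      pair i = trans (group-solve 3 (λ x y z → (y ⊕ x) ⊕ (z ⊕ x) ⊜ (x ⊕ x) ⊕ (y ⊕ z)) (hh (flip² (β i j) u) j) _ _)
        (trans (∙-congˡ
          (trans (∙-congˡ (reflexive (≡.cong (λ s → tt s i) (flip²-opposite (β i j) 0F))))
            (tt-pair (flip² (β i j) 0F) i)))
          (reflexive (≡.cong g (xor-comm (parity (toℕ i)) (parity (toℕ j))))))

    -- Each block on a diagonal contributes one complementary pair, hence σ, and the number of
    -- blocks is even.
    all-σ : {f : Fin m → Carrier} → (∀ i → f i ≈ σ) → sum f ≈ ε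
    all-σ f≈σ = trans (sum-cong-≋ f≈σ) (sum-alternating Γ k (λ _ → σ) σσ≈ε)

-- Even side

even⊎odd : ∀ n → (∃[ k ] n ≡ k * 2) ⊎ (∃[ k ] n ≡ suc (k + k))
even⊎odd zero    = inj₁ (0 , ≡.refl)
even⊎odd (suc n) with even⊎odd n
... | inj₁ (k , ≡.refl) = inj₂ (k , ≡.cong suc (≡.trans (ℕ.*-comm k 2) (≡.cong (k +_) (ℕ.+-identityʳ k))))
... | inj₂ (k , ≡.refl) =
  inj₁ (suc k , ≡.cong (2 +_) (≡.trans (≡.cong (k +_) (≡.sym (ℕ.+-identityʳ k))) (ℕ.*-comm 2 k)))

oddSize-suc : ∀ k → oddSize k ≡ suc (suc k + suc k)
oddSize-suc zero    = ≡.refl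
oddSize-suc (suc k) = ≡.cong (2 +_) (≡.trans (oddSize-suc k) (≡.cong suc (≡.sym (ℕ.+-suc k (suc k)))))

module _ {Γ : AbelianGroup c ℓ} where
  open AbelianGroup Γ
  open AbelianGroupSolver Γ using (group-solve; by-hypothesis; _⊕_; _⊜_; 0′)

  -- The second involution has to lie in K. The projection of κ is κ or κ + σ, and it is nonzero
  -- because κ is neither 0 nor σ.
  projected-klein : ∀ {σ κ} → IsInvolution Γ σ → IsInvolution Γ κ → ¬ κ ≈ σ → (K : Complement {Γ = Γ} σ) →
    Σ[ V ∈ KleinSubgroup Γ ] KleinSubgroup.a V ≡ σ × Congruence._~_ (Complement.C K) (KleinSubgroup.b V) ε
  projected-klein {σ} {κ} σ-involution κ-involution κ≉σ K = record
    { a = σ ; b = π κ ; a-involution = σ-involution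
    ; b-involution = πκ≉ε , trans (group-solve 2 (λ x y → (x ⊕ y) ⊕ (x ⊕ y) ⊜ (x ⊕ x) ⊕ (y ⊕ y)) κ (χ κ))
        (trans (∙-cong (proj₂ κ-involution) (In⟨σ⟩-double (χ-In⟨σ⟩ κ))) (identityˡ ε))
    ; a≉b = λ σ≈πκ → σ≁ε (~-trans (≈⇒~ σ≈πκ) (π~ε κ))
    } , ≡.refl , π~ε κ
    where
    open Projection {Γ = Γ} (proj₂ σ-involution) K
    πκ≉ε : ¬ π κ ≈ ε
    πκ≉ε πκ≈ε with π-absorb κ
    ... | inj₁ πκ≈κ  = proj₁ κ-involution (trans (sym πκ≈κ) πκ≈ε)
    ... | inj₂ πκ≈κσ = κ≉σ (by-hypothesis (trans (sym πκ≈κσ) (trans πκ≈ε (sym (proj₂ σ-involution))))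
      (group-solve 2 (λ κ σ → κ ⊕ (σ ⊕ σ) ⊜ σ ⊕ (κ ⊕ σ)) κ σ))

  module _ (V : KleinSubgroup Γ) (m : ℕ) (I : HasOrder Γ (m * 2 * (m * 2))) where
    open KleinSubgroup V
    open FiniteProperties setoid I using (_≈?_; search)

    Q : KleinQuotient V (m * 2 * (m * 2))
    Q = kleinQuotient V I

    quotient-order : Finite (AbelianGroup.setoid (Congruence.quotient (KleinQuotient.C Q))) (m * m)
    quotient-order =
      ≡.subst (Finite _) (ℕ.*-cancelʳ-≡ _ (m * m) 4 (≡.trans (KleinQuotient.q*4≡N Q) (square m)))
      (KleinQuotient.coset-count Q)
      where
      square : ∀ m → m * 2 * (m * 2) ≡ m * m * 4
      square = solve 1 (λ m → m :* con 2 :* (m :* con 2) := m :* m :* con 4) ≡.refl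
        where open +-*-Solver

    nonDouble? : Dec (∃[ σ ] IsInvolution Γ σ × (∀ y → ¬ y ∙ y ≈ σ))
    nonDouble? = search
      (λ x≈y ((x≉ε , xx≈ε) , not-double) →
        ((λ y≈ε → x≉ε (trans x≈y y≈ε)) , trans (∙-cong (sym x≈y) (sym x≈y)) xx≈ε) ,
        λ z zz≈y → not-double z (trans zz≈y (sym x≈y)))
      (λ σ → (¬? (σ ≈? ε) ×-dec ((σ ∙ σ) ≈? ε)) ×-dec
        map′ (λ none y yy≈σ → none (y , yy≈σ)) (λ none (y , yy≈σ) → none y yy≈σ)
          (¬? (search (λ x≈y xx≈σ → trans (∙-cong (sym x≈y) (sym x≈y)) xx≈σ) (λ y → (y ∙ y) ≈? σ))))

    halves : ¬ (∃[ σ ] IsInvolution Γ σ × (∀ y → ¬ y ∙ y ≈ σ)) → ∀ {ι} → IsInvolution Γ ι → ∃[ y ] y ∙ y ≈ ι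
    halves none {ι} ι-involution with search (λ x≈y xx≈ι → trans (∙-cong (sym x≈y) (sym x≈y)) xx≈ι)
      (λ y → (y ∙ y) ≈? ι)
    ... | yes found = found
    ... | no missing = contradiction (ι , ι-involution , λ y yy≈ι → missing (y , yy≈ι)) none

    other-involution : ∀ σ → ∃[ κ ] IsInvolution Γ κ × ¬ κ ≈ σ
    other-involution σ with a ≈? σ
    ... | no  a≉σ = a , a-involution , a≉σ
    ... | yes a≈σ = b , b-involution , λ b≈σ → a≉b (trans a≈σ (sym b≈σ))

    -- Doubling is constant on cosets of V. As 0, g and h have distinct doubles 0, a and b, their
    -- cosets are distinct, while 2g and 2h fall into V.
    quotient-klein : ∀ {g h} → g ∙ g ≈ a → h ∙ h ≈ b →
      KleinSubgroup (Congruence.quotient (KleinQuotient.C Q))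
    quotient-klein {g} {h} gg≈a hh≈b = record
      { a = g ; b = h
      ; a-involution =
        (λ g~ε → proj₁ a-involution
          (trans (sym gg≈a) (trans (double-coset g~ε) (identityˡ ε)))) , vanish 𝐚 gg≈a
      ; b-involution =
        (λ h~ε → proj₁ b-involution
          (trans (sym hh≈b) (trans (double-coset h~ε) (identityˡ ε)))) , vanish 𝐛 hh≈b
      ; a≉b = λ g~h → a≉b (trans (sym gg≈a) (trans (double-coset g~h) hh≈b))
      }
      where
      open KleinQuotient Q
      open Congruence C using (_~_; ≈⇒~; ~-trans)
      vanish : ∀ d {x} → x ∙ x ≈ ν d → x ∙ x ~ ε
      vanish d xx≈ν = ~-trans (≈⇒~ (trans xx≈ν (sym (identityˡ _)))) (≈⇒~ν d)
      double-coset : ∀ {x y} → x ~ y → x ∙ x ≈ y ∙ y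
      double-coset x~y with expand x~y
      ... | inj₁ x≈y = ∙-cong x≈y x≈y
      ... | inj₂ (d , x≈yν) = trans (∙-cong x≈yν x≈yν) (by-hypothesis (ν-double V d)
        (group-solve 2 (λ y v → ((y ⊕ v) ⊕ (y ⊕ v)) ⊕ 0′ ⊜ (y ⊕ y) ⊕ (v ⊕ v)) _ (ν d)))

  -- V supplies an involution other than σ; the square is then built on the Klein four-group of σ
  -- and the projection of that involution to K.
  splitArray : (V : KleinSubgroup Γ) → ∀ k → HasOrder Γ (k * 2 * 2 * (k * 2 * 2)) →
    (∃[ σ ] IsInvolution Γ σ × (∀ y → ¬ y ∙ y ≈ σ)) → ZeroSumArray Γ (k * 2 * 2)
  splitArray V k I (σ , σ-involution , not-double) =
    let (κ , κ-involution , κ≉σ) = other-involution V (k * 2) I σ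
        K = complement I not-double
    in build K (projected-klein σ-involution κ-involution κ≉σ K)
    where
    build : ∀ {σ} (K : Complement {Γ = Γ} σ) →
      Σ[ V ∈ KleinSubgroup Γ ] KleinSubgroup.a V ≡ σ × Congruence._~_ (Complement.C K)
        (KleinSubgroup.b V) ε →
      ZeroSumArray Γ (k * 2 * 2)
    build K (W , ≡.refl , ι~ε) =
      checkerboardArray W K ι~ε (Q W (k * 2) I) k (tiling (k * 2) (k * 2) (quotient-order W (k * 2) I))

  twiceOddArray : (V : KleinSubgroup Γ) → ∀ k → let m = oddSize k in HasOrder Γ (m * 2 * (m * 2)) →
    ZeroSumArray Γ (m * 2)
  twiceOddArray V k I = liftArray V (Q V (oddSize k) I)
    (oddArray _ (suc k) (oddSize-suc k) (quotient-order V (oddSize k) I)) (odd-pattern V k)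

evenArray : ∀ {m} → Acc _<_ m → 1 < m → {Γ : AbelianGroup c ℓ} → KleinSubgroup Γ →
  HasOrder Γ (m * 2 * (m * 2)) → ZeroSumArray Γ (m * 2)
evenArray {m = m} (acc rec) 1<m {Γ} V I with even⊎odd m
... | inj₂ (zero , ≡.refl) = contradiction 1<m (ℕ.<-irrefl ≡.refl)
... | inj₂ (suc k , ≡.refl) =
  ≡.subst (λ m → HasOrder Γ (m * 2 * (m * 2)) → ZeroSumArray Γ (m * 2)) (oddSize-suc k)
    (twiceOddArray V k) I
... | inj₁ (k , ≡.refl) = case nonDouble? V (k * 2) I of λ where
    (yes σ)   → splitArray V k I σ
    (no none) → halved k 1<m rec I (halves V (k * 2) I none (KleinSubgroup.a-involution V))
      (halves V (k * 2) I none (KleinSubgroup.b-involution V))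
  where
  open AbelianGroup Γ
  open KleinSubgroup V
  halved : ∀ k → 1 < k * 2 → (∀ {y} → y < k * 2 → Acc _<_ y) → (I : HasOrder Γ (k * 2 * 2 * (k * 2 * 2))) →
    ∃[ g ] g ∙ g ≈ a → ∃[ h ] h ∙ h ≈ b → ZeroSumArray Γ (k * 2 * 2)
  -- Side 4: the descent to Γ/V would call for a square of side 2, and there is none.
  halved (suc zero) _ _ _ (g , gg≈a) (h , hh≈b) = array₄ V gg≈a hh≈b
  halved k@(suc (suc k′)) _ rec I (g , gg≈a) (h , hh≈b) = liftArray V (Q V (k * 2) I)
    (evenArray (rec (ℕ.m<m*n k 2 (s≤s (s≤s z≤n)))) (s≤s (s≤s z≤n)) (quotient-klein V (k * 2) I gg≈a hh≈b)
      (quotient-order V (k * 2) I))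
    (even-pattern V k)

-- Necessity

module _ (Γ : AbelianGroup c ℓ) where
  open AbelianGroup Γ
  open Sum commutativeMonoid using (sum; sum-cong-≋; ∑-distrib-+; sum-remove)
  open SumProperties commutativeMonoid using (sum-injective; sum-zero)

  sum-singleton : ∀ {n} (t : Fin n → Carrier) i → (∀ j → j ≢ i → t j ≈ ε) → sum t ≈ t i
  sum-singleton {suc n} t i vanishes = trans (sum-remove {i = i} t)
    (trans (∙-congˡ (sum-zero (λ j → vanishes (punchIn i j) (punchInᵢ≢i i j)))) (identityʳ (t i)))

  only-fixed : ∀ {n} {i j : Fin n} → Tri (i Fin.< j) (i ≡ j) (j Fin.< i) → Carrier → Carrier
  only-fixed (tri< _ _ _) x = ε
  only-fixed (tri≈ _ _ _) x = x
  only-fixed (tri> _ _ _) x = ε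

  -- Points moved by the involution f cancel in pairs.
  sum-fixed : ∀ {n} {f : Fin n → Fin n} → (∀ i → f (f i) ≡ i) → {t : Fin n → Carrier} →
    (∀ i → t i ∙ t (f i) ≈ ε) → sum t ≈ sum (λ i → only-fixed (<-cmp i (f i)) (t i))
  sum-fixed {n} {f} ff≡id {t} tt≈ε = begin
    sum t
      ≈⟨ sum-cong-≋ (λ i → split (<-cmp i (f i)) (t i)) ⟩
    sum (λ i → below i ∙ (above i ∙ fixed i))
      ≈⟨ trans (∑-distrib-+ below _) (∙-congˡ (∑-distrib-+ above fixed)) ⟩
    sum below ∙ (sum above ∙ sum fixed)
      ≈⟨ assoc _ _ _ ⟨
    sum below ∙ sum above ∙ sum fixed
      ≈⟨ ∙-congʳ (∙-congˡ (sum-injective above f-injective)) ⟨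
    -- Of two points exchanged by f one lies below its image and the other above; composing with f
    -- aligns the second sum with the first.
    sum below ∙ sum (above ∘ f) ∙ sum fixed
      ≈⟨ ∙-congʳ (∑-distrib-+ below (above ∘ f)) ⟨
    sum (λ i → below i ∙ above (f i)) ∙ sum fixed
      ≈⟨ ∙-congʳ (sum-zero (λ i → cancel i (<-cmp i (f i)) (<-cmp (f i) (f (f i))))) ⟩
    ε ∙ sum fixed
      ≈⟨ identityˡ _ ⟩
    sum fixed ∎
    where
    open SetoidReasoning setoid
    only-below only-above : ∀ {i j : Fin n} → Tri (i Fin.< j) (i ≡ j) (j Fin.< i) → Carrier → Carrier
    only-below (tri< _ _ _) x = x
    only-below (tri≈ _ _ _) x = ε
    only-below (tri> _ _ _) x = ε
    only-above (tri< _ _ _) x = ε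
    only-above (tri≈ _ _ _) x = ε
    only-above (tri> _ _ _) x = x
    below above fixed : Fin n → Carrier
    below i = only-below (<-cmp i (f i)) (t i)
    above i = only-above (<-cmp i (f i)) (t i)
    fixed i = only-fixed (<-cmp i (f i)) (t i)
    f-injective : ∀ {i j} → f i ≡ f j → i ≡ j
    f-injective {i} {j} eq = ≡.trans (≡.sym (ff≡id i)) (≡.trans (≡.cong f eq) (ff≡id j))
    split : ∀ {i j : Fin n} (τ : Tri (i Fin.< j) (i ≡ j) (j Fin.< i)) x →
      x ≈ only-below τ x ∙ (only-above τ x ∙ only-fixed τ x)
    split (tri< _ _ _) x = sym (trans (∙-congˡ (identityˡ ε)) (identityʳ x))
    split (tri≈ _ _ _) x = sym (trans (identityˡ _) (identityˡ x))
    split (tri> _ _ _) x = sym (trans (identityˡ _) (identityʳ x))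
    cancel : ∀ i (τ : Tri (i Fin.< f i) (i ≡ f i) (f i Fin.< i))
      (υ : Tri (f i Fin.< f (f i)) (f i ≡ f (f i)) (f (f i) Fin.< f i)) →
      only-below τ (t i) ∙ only-above υ (t (f i)) ≈ ε
    cancel i (tri< _ _ _)      (tri> _ _ _)      = tt≈ε i
    cancel i (tri< i<fi _ _)   (tri< _ _ ¬ffi<fi) =
      contradiction (≡.subst (Fin._< f i) (≡.sym (ff≡id i)) i<fi) ¬ffi<fi
    cancel i (tri< i<fi _ _)   (tri≈ _ _ ¬ffi<fi) =
      contradiction (≡.subst (Fin._< f i) (≡.sym (ff≡id i)) i<fi) ¬ffi<fi
    cancel i (tri≈ ¬i<fi _ _)  (tri> _ _ ffi<fi) =
      contradiction (≡.subst (Fin._< f i) (ff≡id i) ffi<fi) ¬i<fi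
    cancel i (tri> ¬i<fi _ _)  (tri> _ _ ffi<fi) =
      contradiction (≡.subst (Fin._< f i) (ff≡id i) ffi<fi) ¬i<fi
    cancel i (tri≈ _ _ _)      (tri< _ _ _)      = identityˡ ε
    cancel i (tri≈ _ _ _)      (tri≈ _ _ _)      = identityˡ ε
    cancel i (tri> _ _ _)      (tri< _ _ _)      = identityˡ ε
    cancel i (tri> _ _ _)      (tri≈ _ _ _)      = identityˡ ε

-- Z/2, used for counting: the constant `true` cancels along exchanged pairs, so its sum is the
-- number of fixed points modulo 2.
parityGroup : AbelianGroup _ _
parityGroup = CommutativeRing.+-abelianGroup xor-∧-commutativeRing

module _ (Γ : AbelianGroup c ℓ) {N : ℕ} (I : HasOrder Γ N) where
  open AbelianGroup Γ
  open Sum commutativeMonoid using (sum)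
  open FiniteProperties setoid I using (to; from; to-injective; strictlyInverseˡ; _≈?_; search)

  negate : Fin N → Fin N
  negate i = from (to i ⁻¹)

  to-negate : ∀ i → to (negate i) ≈ to i ⁻¹
  to-negate i = strictlyInverseˡ _

  negate-involutive : ∀ i → negate (negate i) ≡ i
  negate-involutive i =
    to-injective
      (trans (to-negate (negate i))
        (trans (⁻¹-cong (to-negate i)) (GroupProperties.⁻¹-involutive group (to i))))

  fixed⇒double : ∀ {i} → i ≡ negate i → to i ∙ to i ≈ ε
  fixed⇒double {i} i≡ = trans (∙-congˡ (trans (reflexive (≡.cong to i≡)) (to-negate i))) (inverseʳ (to i))

  double⇒fixed : ∀ {i} → to i ∙ to i ≈ ε → i ≡ negate i
  double⇒fixed {i} ii≈ε =
    to-injective (trans (GroupProperties.inverseˡ-unique group (to i) (to i) ii≈ε) (sym (to-negate i)))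

  involution? : ∀ x → Dec (IsInvolution Γ x)
  involution? x = ¬? (x ≈? ε) ×-dec ((x ∙ x) ≈? ε)

  involution-resp : ∀ {x y} → x ≈ y → IsInvolution Γ x → IsInvolution Γ y
  involution-resp x≈y (x≉ε , xx≈ε) = (λ y≈ε → x≉ε (trans x≈y y≈ε)) , trans (∙-cong (sym x≈y) (sym x≈y)) xx≈ε

  -- Without involutions 0 would be the only fixed point of negation, and N would be odd.
  even⇒involution : ∀ k → N ≡ k * 2 → ∃ (IsInvolution Γ)
  even⇒involution k N≡k*2 with search involution-resp involution?
  ... | yes found = found
  ... | no none = case odd of λ ()
    where
    ones : Fin N → Bool
    ones _ = true
    fixed : Fin N → Bool
    fixed i = only-fixed parityGroup (<-cmp i (negate i)) true
    zero-index : Fin N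
    zero-index = from ε
    fixed-false : ∀ i → i ≢ zero-index → fixed i ≡ false
    fixed-false i i≢0 with <-cmp i (negate i)
    ... | tri< _ _ _ = ≡.refl
    ... | tri> _ _ _ = ≡.refl
    ... | tri≈ _ i≡ _ =
      contradiction
        (to i , (λ i≈ε → i≢0 (to-injective (trans i≈ε (sym (strictlyInverseˡ ε))))) , fixed⇒double i≡) none
    fixed-zero : fixed zero-index ≡ true
    fixed-zero with <-cmp zero-index (negate zero-index)
    ... | tri≈ _ _ _  = ≡.refl
    ... | tri< _ ≢ _  =
      contradiction
        (double⇒fixed (trans (∙-cong (strictlyInverseˡ ε) (strictlyInverseˡ ε)) (identityˡ ε))) ≢
    ... | tri> _ ≢ _  =
      contradiction
        (double⇒fixed (trans (∙-cong (strictlyInverseˡ ε) (strictlyInverseˡ ε)) (identityˡ ε))) ≢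
    odd : false ≡ true
    odd =
      ≡.trans (≡.sym
        (≡.subst (λ n → Sum.sum (AbelianGroup.commutativeMonoid parityGroup) {n} (λ _ → true) ≡ false)
          (≡.sym N≡k*2)
            (sum-alternating parityGroup k (λ _ → true) ≡.refl)))
      (≡.trans (sum-fixed parityGroup {f = negate} negate-involutive {ones} (λ _ → ≡.refl))
      (≡.trans (sum-singleton parityGroup fixed zero-index fixed-false) fixed-zero))

  zero-sum⇒two-involutions : sum to ≈ ε → ∃ (IsInvolution Γ) → MoreThanOneInvolution Γ
  zero-sum⇒two-involutions Σ≈ε (ι , ι-involution)
    with search (λ { x≈y (x-inv , x≉ι) → involution-resp x≈y x-inv , λ y≈ι → x≉ι (trans x≈y y≈ι) })
                (λ κ → involution? κ ×-dec ¬? (κ ≈? ι))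
  ... | yes (κ , κ-involution , κ≉ι) = κ , ι , κ-involution , ι-involution , κ≉ι
  ... | no none =
    contradiction (trans (sym fixed-ι) (trans (sym (sum-singleton Γ fixed (from ι) fixed-trivial))
        (trans (sym
          (sum-fixed Γ {f = negate} negate-involutive {to}
            (λ i → trans (∙-congˡ (to-negate i)) (inverseʳ (to i))))) Σ≈ε)))
        (proj₁ ι-involution)
    where
    fixed : Fin N → Carrier
    fixed i = only-fixed Γ (<-cmp i (negate i)) (to i)
    ι-fixed : from ι ≡ negate (from ι)
    ι-fixed = double⇒fixed (trans (∙-cong (strictlyInverseˡ ι) (strictlyInverseˡ ι)) (proj₂ ι-involution))
    fixed-ι : fixed (from ι) ≈ ι
    fixed-ι with <-cmp (from ι) (negate (from ι))
    ... | tri≈ _ _ _ = strictlyInverseˡ ι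
    ... | tri< _ ≢ _ = contradiction ι-fixed ≢
    ... | tri> _ ≢ _ = contradiction ι-fixed ≢
    fixed-trivial : ∀ i → i ≢ from ι → fixed i ≈ ε
    fixed-trivial i i≢ι with <-cmp i (negate i)
    ... | tri< _ _ _ = refl
    ... | tri> _ _ _ = refl
    ... | tri≈ _ i≡ _ with to i ≈? ε
    ...   | yes i≈ε = i≈ε
    ...   | no  i≉ε =
      contradiction
        (to i , (i≉ε , fixed⇒double i≡) , λ i≈ι → i≢ι
          (to-injective (trans i≈ι (sym (strictlyInverseˡ ι))))) none

-- Constraints imposed by a magic square, and the equivalence.

module _ {Γ : AbelianGroup c ℓ} {n : ℕ} (S : MagicSquare Γ n) where
  open AbelianGroup Γ
  open Sum commutativeMonoid using (sum; sum-cong-≋)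
  open SumProperties commutativeMonoid using (sum-reindex; sum-combine; sum-zero)
  open MagicSquare S

  entry-unique : ∀ {i i′ j j′} → entry i j ≈ entry i′ j′ → i ≡ i′ × j ≡ j′
  entry-unique {i} {i′} {j} {j′} eq =
    let (_ , _ , unique) = each-once (entry i′ j′)
    in ,-injective (≡.trans (≡.sym (unique {i , j} eq)) (unique {i′ , j′} refl))

  square-enumeration : HasOrder Γ (n * n)
  square-enumeration = mkFinite-× setoid entry entry-unique
    (λ g → let ((i , j) , eq , _) = each-once g in i , j , eq)

  total-sum : ∀ {N} (I : HasOrder Γ N) → μ ≈ ε → sum (Inverse.to I) ≈ ε
  total-sum I μ≈ε = trans (sum-reindex setoid I square-enumeration id id)
    (trans (sum-combine n (Inverse.to square-enumeration))
      (sum-zero (λ i → trans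
        (sum-cong-≋ (λ j → reflexive (≡.cong (uncurry entry) (remQuot-combine {n} {n} i j))))
        (trans (row-sum i) μ≈ε))))

-- The first row and the first column share a corner, so their other entries agree, whatever the
-- magic constant.
no-square-of-side-two : {Γ : AbelianGroup c ℓ} → ¬ MagicSquare Γ 2
no-square-of-side-two {Γ = Γ} S = case entry-unique S {0F} {1F} {1F} {0F} corner of λ ()
  where
  open AbelianGroup Γ
  open MagicSquare S
  corner : entry 0F 1F ≈ entry 1F 0F
  corner = AbelianGroupProperties.∙-cancelʳ Γ ε _ _
    (AbelianGroupProperties.∙-cancelˡ Γ (entry 0F 0F) _ _ (trans (row-sum 0F) (sym (column-sum 0F))))

side>2 : {Γ : AbelianGroup c ℓ} → ∀ n → 0 < n → n ≢ 1 → MagicSquare Γ n → 2 < n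
side>2 1 _ n≢1 _ = contradiction ≡.refl n≢1
side>2 2 _ _   S = ⊥-elim (no-square-of-side-two S)
side>2 (suc (suc (suc n))) _ _ _ = s≤s (s≤s (s≤s z≤n))

zero-sum⇒∈𝒢 : {Γ : AbelianGroup c ℓ} → ∀ {n N} → HasOrder Γ N → (S : MagicSquare Γ n) → ZeroSum {Γ = Γ} S →
  Γ ∈𝒢
zero-sum⇒∈𝒢 {Γ = Γ} {N = N} I S μ≈ε with 2 ∣? N
... | no  2∤N = N , I , inj₁ 2∤N
... | yes (divides k N≡k*2) = N , I ,
  inj₂ (zero-sum⇒two-involutions Γ I (total-sum S I μ≈ε) (even⇒involution Γ I k N≡k*2))

zeroSumArray : {Γ : AbelianGroup c ℓ} → ∀ {n} → 2 < n → HasOrder Γ (n * n) → Γ ∈𝒢 → ZeroSumArray Γ n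
zeroSumArray {Γ = Γ} {n} 2<n I Γ∈𝒢 with even⊎odd n
... | inj₂ (k , n≡) = oddArray Γ k n≡ I
... | inj₁ (m , ≡.refl) = evenArray (<-wellFounded m) (ℕ.*-cancelʳ-< 2 1 m 2<n) (klein Γ∈𝒢) I
  where
  klein : Γ ∈𝒢 → KleinSubgroup Γ
  klein (_ , _ , inj₂ (a , b , a-involution , b-involution , a≉b)) =
    record { a-involution = a-involution ; b-involution = b-involution ; a≉b = a≉b }
  -- Odd order is impossible here: the order carried by membership must equal n² for an even n.
  klein (_ , J , inj₁ 2∤N) = contradiction
    (divides (m * 2 * m)
      (≡.trans (Finite-unique (AbelianGroup.setoid Γ) J I) (≡.sym (ℕ.*-assoc (m * 2) m 2)))) 2∤N

theorem1p3 : ∀ {c ℓ} (n : ℕ) → 0 < n → (Γ : AbelianGroup c ℓ) → HasOrder Γ (n ^ 2) → 1 < n ^ 2 →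
    (∃[ S ] (NonTrivial {Γ = Γ} {n = n} S × ZeroSum S)) ⇔ (2 < n × Γ ∈𝒢)
theorem1p3 n 0<n Γ I _ = mk⇔
  (λ (S , n≢1 , μ≈ε) → side>2 n 0<n n≢1 S , zero-sum⇒∈𝒢 I S μ≈ε)
  (λ (2<n , Γ∈𝒢) →
    -- `n ^ 2` unfolds to `n * (n * 1)`.
    let I′ = ≡.subst (HasOrder Γ) (≡.cong (n *_) (ℕ.*-identityʳ n)) I
        (S , μ≈ε) = toMagicSquare I (zeroSumArray 2<n I′ Γ∈𝒢)
    in S , (λ { ≡.refl → case 2<n of λ { (s≤s ()) } }) , μ≈ε)
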